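{- Let $g:\mathbb{N}\to\mathbb{C}$ be an arithmetic function, where $\mathbb{N}$ is the set of positive integers, and let $$F_g(x)=\exp\left(-\sum_{n\ge1}\frac{g(n)}{n}x^n\right)\in\mathbb{C}[[x]].$$ Then $F_g(x)$ admits the Euler-product expansion $$F_g(x)=\prod_{m\ge1}(1-x^m)^{\beta_g(m)},$$ where the exponents $\beta_g(m)$ are given, for every $m\ge 1$, by $$\beta_g(m)=\frac1m\sum_{d\mid m}\mu(d)\,g(m/d),$$ equivalently $m\,\beta_g(m)=(\mu*g)(m)$.
   Context: All identities are in the ring of formal power series $\mathbb{C}[[x]]$. For $\beta\in\mathbb{C}$ and $m\ge1$, $(1-x^m)^{\beta}$ denotes the formal power series $\exp(\beta\log(1-x^m))$ with $\log(1-x^m)=-\sum_{r\ge1}x^{mr}/r$; infinite products are taken in the usual ($x$-adic) sense. $\mu$ is the Möbius function, and $(f*h)(n)=\sum_{d\mid n}f(d)h(n/d)$ is Dirichlet convolution. $F_g$ is called the formal Bell transform of $g$ and the numbers $\beta_g(m)$ its Bell exponents. -}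

module Defs where

open import Algebra.Bundles using (CommutativeRing)
open import Data.Bool.Base using (if_then_else_)
open import Data.Fin.Base using (toℕ)
open import Data.Integer.Base as ℤ using (ℤ; +_; 0ℤ; 1ℤ; -1ℤ)
open import Data.List.Base using (length)
open import Data.List.Relation.Unary.Unique.DecPropositional using (unique?)
open import Data.Nat.Base as ℕ using (ℕ; zero; suc; NonZero; _∸_; _!)
open import Data.Nat.Divisibility using (_∣_; _∣?_; quotient; quotient≢0)
import Data.Nat.Properties as ℕ
open import Data.Nat.Primality.Factorisation using (factorise; factors)
open import Data.Product.Base using (_×_; _,_; ∃)
open import Data.Rational.Base as ℚ using (ℚ; 0ℚ; 1ℚ; ½)
import Data.Rational.Properties as ℚ
import Data.Rational.Solver as ℚ-Solver
open import Level using (0ℓ)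
open import Relation.Binary.PropositionalEquality.Core as ≡ using (_≡_; refl)
open import Relation.Nullary.Decidable using (Dec; yes; no; does)

-- The reals are Cauchy sequences of rationals under the usual equivalence.
-- x ~ y says that x m and y n get arbitrarily close for large m and n, so that
-- x ~ x is the Cauchy condition, and on Cauchy sequences x ~ y holds exactly
-- when x n - y n tends to 0.

infix 4 _~_

_~_ : (ℕ → ℚ) → (ℕ → ℚ) → Set
x ~ y = ∀ ε → 0ℚ ℚ.< ε →
  ∃ λ N → ∀ m n → N ℕ.≤ m → N ℕ.≤ n → ℚ.∣ x m ℚ.- y n ∣ ℚ.< ε

record ℝ : Set where
  no-eta-equality
  field
    seq    : ℕ → ℚ
    cauchy : seq ~ seq

open ℝ

private
  open ℚ-Solver.+-*-Solver using (solve; con; _:=_; _:+_; _:*_; _:-_; :-_)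

  ∣-∣-comm : ∀ p q → ℚ.∣ p ℚ.- q ∣ ≡ ℚ.∣ q ℚ.- p ∣
  ∣-∣-comm p q = ≡.trans (≡.sym (ℚ.∣-p∣≡∣p∣ (p ℚ.- q)))
    (≡.cong ℚ.∣_∣ (solve 2 (λ p q → :- (p :- q) := q :- p) refl p q))

  -- If d = a + b, ∣ a ∣ < ε/2 and ∣ b ∣ < ε/2 then ∣ d ∣ < ε.
  halve : ∀ {ε d} a b → d ≡ a ℚ.+ b →
          ℚ.∣ a ∣ ℚ.< ½ ℚ.* ε → ℚ.∣ b ∣ ℚ.< ½ ℚ.* ε → ℚ.∣ d ∣ ℚ.< ε
  halve {ε} a b refl a<ε b<ε = begin-strict
    ℚ.∣ a ℚ.+ b ∣            ≤⟨ ℚ.∣p+q∣≤∣p∣+∣q∣ a b ⟩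
    ℚ.∣ a ∣ ℚ.+ ℚ.∣ b ∣      <⟨ ℚ.+-mono-< a<ε b<ε ⟩
    ½ ℚ.* ε ℚ.+ ½ ℚ.* ε      ≡⟨ ≡.sym (ℚ.*-distribʳ-+ ε ½ ½) ⟩
    1ℚ ℚ.* ε                 ≡⟨ ℚ.*-identityˡ ε ⟩
    ε                        ∎
    where open ℚ.≤-Reasoning

  *-pos : ∀ {p q} → 0ℚ ℚ.< p → 0ℚ ℚ.< q → 0ℚ ℚ.< p ℚ.* q
  *-pos {p} {q} 0<p 0<q = ℚ.positive⁻¹ (p ℚ.* q)
    {{ℚ.pos*pos⇒pos p {{ℚ.positive 0<p}} q {{ℚ.positive 0<q}}}}

  half-pos : ∀ {ε} → 0ℚ ℚ.< ε → 0ℚ ℚ.< ½ ℚ.* ε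
  half-pos = *-pos (ℚ.positive⁻¹ ½)

  ~-sym : ∀ {x y} → x ~ y → y ~ x
  ~-sym {x} {y} x~y ε ε>0 with x~y ε ε>0
  ... | N , h = N , λ m n N≤m N≤n →
    ≡.subst (ℚ._< ε) (∣-∣-comm (x n) (y m)) (h n m N≤n N≤m)

  ~-trans : ∀ {x y z} → x ~ y → y ~ z → x ~ z
  ~-trans {x} {y} {z} x~y y~z ε ε>0
    with x~y (½ ℚ.* ε) (half-pos ε>0) | y~z (½ ℚ.* ε) (half-pos ε>0)
  ... | N , h | M , k = N ℕ.⊔ M , λ m n p q →
    halve (x m ℚ.- y m) (y m ℚ.- z n)
      (solve 3 (λ a b c → a :- c := (a :- b) :+ (b :- c)) refl (x m) (y m) (z n))
      (h m m (ℕ.m⊔n≤o⇒m≤o N M p) (ℕ.m⊔n≤o⇒m≤o N M p))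
      (k m n (ℕ.m⊔n≤o⇒n≤o N M p) (ℕ.m⊔n≤o⇒n≤o N M q))

  ~-reflexive : ∀ {x y} → x ~ x → (∀ n → x n ≡ y n) → x ~ y
  ~-reflexive {x} {y} x~x x≗y ε ε>0 with x~x ε ε>0
  ... | N , h = N , λ m n p q →
    ≡.subst (λ t → ℚ.∣ x m ℚ.- t ∣ ℚ.< ε) (x≗y n) (h m n p q)

  +-cong~ : ∀ {x x′ y y′} → x ~ x′ → y ~ y′ →
            (λ n → x n ℚ.+ y n) ~ (λ n → x′ n ℚ.+ y′ n)
  +-cong~ {x} {x′} {y} {y′} x~x′ y~y′ ε ε>0
    with x~x′ (½ ℚ.* ε) (half-pos ε>0) | y~y′ (½ ℚ.* ε) (half-pos ε>0)
  ... | N , h | M , k = N ℕ.⊔ M , λ m n p q →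
    halve (x m ℚ.- x′ n) (y m ℚ.- y′ n)
      (solve 4 (λ a b c d → (a :+ c) :- (b :+ d) := (a :- b) :+ (c :- d)) refl
        (x m) (x′ n) (y m) (y′ n))
      (h m n (ℕ.m⊔n≤o⇒m≤o N M p) (ℕ.m⊔n≤o⇒m≤o N M q))
      (k m n (ℕ.m⊔n≤o⇒n≤o N M p) (ℕ.m⊔n≤o⇒n≤o N M q))

  -‿cong~ : ∀ {x x′} → x ~ x′ → (λ n → ℚ.- x n) ~ (λ n → ℚ.- x′ n)
  -‿cong~ {x} {x′} x~x′ ε ε>0 with x~x′ ε ε>0
  ... | N , h = N , λ m n p q → ≡.subst (ℚ._< ε)
    (≡.trans (∣-∣-comm (x m) (x′ n))
      (≡.cong ℚ.∣_∣ (solve 2 (λ a b → b :- a := :- a :- :- b) refl (x m) (x′ n))))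
    (h m n p q)

  bounded : ∀ {x x′} → x ~ x′ →
            ∃ λ B → 0ℚ ℚ.< B × ∃ λ N → ∀ m → N ℕ.≤ m → ℚ.∣ x m ∣ ℚ.< B
  bounded {x} {x′} x~x′ with x~x′ 1ℚ (ℚ.positive⁻¹ 1ℚ)
  ... | N , h = B , ℚ.≤-<-trans (ℚ.nonNegative⁻¹ _ {{ℚ.∣-∣-nonNeg (x N)}}) (bnd N ℕ.≤-refl)
              , N , bnd
    where
    B = 1ℚ ℚ.+ ℚ.∣ x′ N ∣
    bnd : ∀ m → N ℕ.≤ m → ℚ.∣ x m ∣ ℚ.< B
    bnd m N≤m = begin-strict
      ℚ.∣ x m ∣                            ≡⟨ ≡.cong ℚ.∣_∣ (solve 2 (λ a b → a := (a :- b) :+ b) refl (x m) (x′ N)) ⟩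
      ℚ.∣ (x m ℚ.- x′ N) ℚ.+ x′ N ∣        ≤⟨ ℚ.∣p+q∣≤∣p∣+∣q∣ (x m ℚ.- x′ N) (x′ N) ⟩
      ℚ.∣ x m ℚ.- x′ N ∣ ℚ.+ ℚ.∣ x′ N ∣    <⟨ ℚ.+-monoˡ-< ℚ.∣ x′ N ∣ (h m N N≤m ℕ.≤-refl) ⟩
      B                                    ∎
      where open ℚ.≤-Reasoning

  -- For B > 0, δ = ε/B.
  shrink : ∀ B ε → 0ℚ ℚ.< B → 0ℚ ℚ.< ε →
           ∃ λ δ → 0ℚ ℚ.< δ × (∀ a b → ℚ.∣ a ∣ ℚ.< B → ℚ.∣ b ∣ ℚ.< δ → ℚ.∣ a ℚ.* b ∣ ℚ.< ε)
  shrink B ε B>0 ε>0 = δ , *-pos (ℚ.positive⁻¹ (ℚ.1/ B) {{ℚ.1/pos⇒pos B}}) ε>0 , λ a b a<B b<δ → begin-strict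
      ℚ.∣ a ℚ.* b ∣            ≡⟨ ℚ.∣p*q∣≡∣p∣*∣q∣ a b ⟩
      ℚ.∣ a ∣ ℚ.* ℚ.∣ b ∣      ≤⟨ ℚ.*-monoʳ-≤-nonNeg ℚ.∣ b ∣ {{ℚ.∣-∣-nonNeg b}} (ℚ.<⇒≤ a<B) ⟩
      B ℚ.* ℚ.∣ b ∣            <⟨ ℚ.*-monoʳ-<-pos B b<δ ⟩
      B ℚ.* δ                  ≡⟨ ≡.sym (ℚ.*-assoc B (ℚ.1/ B) ε) ⟩
      B ℚ.* ℚ.1/ B ℚ.* ε       ≡⟨ ≡.cong (ℚ._* ε) (ℚ.*-inverseʳ B) ⟩
      1ℚ ℚ.* ε                 ≡⟨ ℚ.*-identityˡ ε ⟩
      ε                        ∎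
    where
    open ℚ.≤-Reasoning
    instance
      _ = ℚ.positive B>0
      _ = ℚ.pos⇒nonZero B
    δ = ℚ.1/ B ℚ.* ε

  split : ∀ a b c d → a ℚ.* c ℚ.- b ℚ.* d ≡ a ℚ.* (c ℚ.- d) ℚ.+ d ℚ.* (a ℚ.- b)
  split = solve 4 (λ a b c d → a :* c :- b :* d := a :* (c :- d) :+ d :* (a :- b)) refl

  max₄ : ∀ a b c d → ∃ λ N → ∀ n → N ℕ.≤ n → a ℕ.≤ n × b ℕ.≤ n × c ℕ.≤ n × d ℕ.≤ n
  max₄ a b c d = (a ℕ.⊔ b) ℕ.⊔ (c ℕ.⊔ d) , λ n N≤n →
    let p = ℕ.m⊔n≤o⇒m≤o (a ℕ.⊔ b) (c ℕ.⊔ d) N≤n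
        q = ℕ.m⊔n≤o⇒n≤o (a ℕ.⊔ b) (c ℕ.⊔ d) N≤n
    in ℕ.m⊔n≤o⇒m≤o a b p , ℕ.m⊔n≤o⇒n≤o a b p , ℕ.m⊔n≤o⇒m≤o c d q , ℕ.m⊔n≤o⇒n≤o c d q

  *-cong~ : ∀ {x x′ y y′} → x ~ x′ → y ~ y′ →
            (λ n → x n ℚ.* y n) ~ (λ n → x′ n ℚ.* y′ n)
  *-cong~ {x} {x′} {y} {y′} x~x′ y~y′ ε ε>0 =
    let B , B>0 , N₁ , h₁ = bounded {x} {x′} x~x′
        C , C>0 , N₂ , h₂ = bounded {y′} {y} (~-sym {y} {y′} y~y′)
        δ , δ>0 , s = shrink B (½ ℚ.* ε) B>0 (half-pos ε>0)
        η , η>0 , t = shrink C (½ ℚ.* ε) C>0 (half-pos ε>0)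
        N₃ , h₃ = y~y′ δ δ>0
        N₄ , h₄ = x~x′ η η>0
        N , N≤ = max₄ N₁ N₂ N₃ N₄
    in N , λ m n p q →
      let m₁ , m₂ , m₃ , m₄ = N≤ m p
          n₁ , n₂ , n₃ , n₄ = N≤ n q
      in halve (x m ℚ.* (y m ℚ.- y′ n)) (y′ n ℚ.* (x m ℚ.- x′ n))
           (split (x m) (x′ n) (y m) (y′ n))
           (s (x m) (y m ℚ.- y′ n) (h₁ m m₁) (h₃ m n m₃ n₃))
           (t (y′ n) (x m ℚ.- x′ n) (h₂ n n₂) (h₄ m n m₄ n₄))

infix  4 _≈ʳ_
infixl 6 _+ʳ_
infixl 7 _*ʳ_
infix  8 -ʳ_

-- A record, so that the two reals can be inferred from a proof of equality.
record _≈ʳ_ (x y : ℝ) : Set where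
  constructor mk≈
  field
    close : seq x ~ seq y

open _≈ʳ_

_+ʳ_ _*ʳ_ : ℝ → ℝ → ℝ
seq    (x +ʳ y) n = seq x n ℚ.+ seq y n
cauchy (x +ʳ y)   = +-cong~ {seq x} {seq x} (cauchy x) (cauchy y)
seq    (x *ʳ y) n = seq x n ℚ.* seq y n
cauchy (x *ʳ y)   = *-cong~ {seq x} {seq x} (cauchy x) (cauchy y)

-ʳ_ : ℝ → ℝ
seq    (-ʳ x) n = ℚ.- seq x n
cauchy (-ʳ x)   = -‿cong~ {seq x} (cauchy x)

ℚ⇒ℝ : ℚ → ℝ
seq    (ℚ⇒ℝ q) _     = q
cauchy (ℚ⇒ℝ q) ε ε>0 = 0 , λ _ _ _ _ →
  ≡.subst (ℚ._< ε) (≡.cong ℚ.∣_∣ (≡.sym (ℚ.+-inverseʳ q))) ε>0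

pointwise : ∀ {x y} → (∀ n → seq x n ≡ seq y n) → x ≈ʳ y
pointwise {x} eq = mk≈ (~-reflexive (cauchy x) eq)

ℝ-commutativeRing : CommutativeRing 0ℓ 0ℓ
ℝ-commutativeRing = record
  { Carrier = ℝ
  ; _≈_ = _≈ʳ_
  ; _+_ = _+ʳ_
  ; _*_ = _*ʳ_
  ; -_  = -ʳ_
  ; 0#  = ℚ⇒ℝ 0ℚ
  ; 1#  = ℚ⇒ℝ 1ℚ
  ; isCommutativeRing = record
    { isRing = record
      { +-isAbelianGroup = record
        { isGroup = record
          { isMonoid = record
            { isSemigroup = record
              { isMagma = record
                { isEquivalence = record
                  { refl  = λ {x} → mk≈ (cauchy x)
                  ; sym   = λ {x} {y} p → mk≈ (~-sym {seq x} {seq y} (close p))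
                  ; trans = λ {x} {y} {z} p q →
                      mk≈ (~-trans {seq x} {seq y} {seq z} (close p) (close q))
                  }
                ; ∙-cong = λ {x} {x′} p q → mk≈ (+-cong~ {seq x} {seq x′} (close p) (close q))
                }
              ; assoc = λ x y z → pointwise λ n → ℚ.+-assoc (seq x n) (seq y n) (seq z n)
              }
            ; identity = (λ x → pointwise λ n → ℚ.+-identityˡ (seq x n))
                       , (λ x → pointwise λ n → ℚ.+-identityʳ (seq x n))
            }
          ; inverse = (λ x → pointwise λ n → ℚ.+-inverseˡ (seq x n))
                    , (λ x → pointwise λ n → ℚ.+-inverseʳ (seq x n))
          ; ⁻¹-cong = λ {x} p → mk≈ (-‿cong~ {seq x} (close p))
          }
        ; comm = λ x y → pointwise λ n → ℚ.+-comm (seq x n) (seq y n)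
        }
      ; *-cong = λ {x} {x′} p q → mk≈ (*-cong~ {seq x} {seq x′} (close p) (close q))
      ; *-assoc = λ x y z → pointwise λ n → ℚ.*-assoc (seq x n) (seq y n) (seq z n)
      ; *-identity = (λ x → pointwise λ n → ℚ.*-identityˡ (seq x n))
                   , (λ x → pointwise λ n → ℚ.*-identityʳ (seq x n))
      ; distrib = (λ x y z → pointwise λ n → ℚ.*-distribˡ-+ (seq x n) (seq y n) (seq z n))
                , (λ x y z → pointwise λ n → ℚ.*-distribʳ-+ (seq x n) (seq y n) (seq z n))
      }
    ; *-comm = λ x y → pointwise λ n → ℚ.*-comm (seq x n) (seq y n)
    }
  }

record ℂ : Set where
  no-eta-equality
  constructor _+i_
  field
    re : ℝ
    im : ℝ

open ℂ

infix  4 _≈ᶜ_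
infixl 6 _+ᶜ_
infixl 7 _*ᶜ_
infix  8 -ᶜ_

record _≈ᶜ_ (z w : ℂ) : Set where
  constructor _+i_
  field
    re≈ : re z ≈ʳ re w
    im≈ : im z ≈ʳ im w

open _≈ᶜ_

_+ᶜ_ _*ᶜ_ : ℂ → ℂ → ℂ
re (z +ᶜ w) = re z +ʳ re w
im (z +ᶜ w) = im z +ʳ im w
re (z *ᶜ w) = re z *ʳ re w +ʳ -ʳ (im z *ʳ im w)
im (z *ᶜ w) = re z *ʳ im w +ʳ im z *ʳ re w

-ᶜ_ : ℂ → ℂ
re (-ᶜ z) = -ʳ re z
im (-ᶜ z) = -ʳ im z

ℚ⇒ℂ : ℚ → ℂ
re (ℚ⇒ℂ q) = ℚ⇒ℝ q
im (ℚ⇒ℂ q) = ℚ⇒ℝ 0ℚ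

private
  module R = CommutativeRing ℝ-commutativeRing

  -- Real and imaginary parts of the laws of complex multiplication.
  assocʳᵉ : ∀ a b c d e f →
    (a *ʳ c +ʳ -ʳ (b *ʳ d)) *ʳ e +ʳ -ʳ ((a *ʳ d +ʳ b *ʳ c) *ʳ f)
    ≈ʳ a *ʳ (c *ʳ e +ʳ -ʳ (d *ʳ f)) +ʳ -ʳ (b *ʳ (c *ʳ f +ʳ d *ʳ e))
  assocʳᵉ a b c d e f = pointwise λ n → solve 6 (λ a b c d e f →
    (a :* c :+ :- (b :* d)) :* e :+ :- ((a :* d :+ b :* c) :* f)
    := a :* (c :* e :+ :- (d :* f)) :+ :- (b :* (c :* f :+ d :* e))) refl
    (seq a n) (seq b n) (seq c n) (seq d n) (seq e n) (seq f n)

  assocⁱᵐ : ∀ a b c d e f →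
    (a *ʳ c +ʳ -ʳ (b *ʳ d)) *ʳ f +ʳ (a *ʳ d +ʳ b *ʳ c) *ʳ e
    ≈ʳ a *ʳ (c *ʳ f +ʳ d *ʳ e) +ʳ b *ʳ (c *ʳ e +ʳ -ʳ (d *ʳ f))
  assocⁱᵐ a b c d e f = pointwise λ n → solve 6 (λ a b c d e f →
    (a :* c :+ :- (b :* d)) :* f :+ (a :* d :+ b :* c) :* e
    := a :* (c :* f :+ d :* e) :+ b :* (c :* e :+ :- (d :* f))) refl
    (seq a n) (seq b n) (seq c n) (seq d n) (seq e n) (seq f n)

  identityˡʳᵉ : ∀ a b →
    ℚ⇒ℝ 1ℚ *ʳ a +ʳ -ʳ (ℚ⇒ℝ 0ℚ *ʳ b)
    ≈ʳ a
  identityˡʳᵉ a b = pointwise λ n → solve 2 (λ a b →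
    con 1ℚ :* a :+ :- (con 0ℚ :* b)
    := a) refl
    (seq a n) (seq b n)

  identityˡⁱᵐ : ∀ a b →
    ℚ⇒ℝ 1ℚ *ʳ b +ʳ ℚ⇒ℝ 0ℚ *ʳ a
    ≈ʳ b
  identityˡⁱᵐ a b = pointwise λ n → solve 2 (λ a b →
    con 1ℚ :* b :+ con 0ℚ :* a
    := b) refl
    (seq a n) (seq b n)

  identityʳʳᵉ : ∀ a b →
    a *ʳ ℚ⇒ℝ 1ℚ +ʳ -ʳ (b *ʳ ℚ⇒ℝ 0ℚ)
    ≈ʳ a
  identityʳʳᵉ a b = pointwise λ n → solve 2 (λ a b →
    a :* con 1ℚ :+ :- (b :* con 0ℚ)
    := a) refl
    (seq a n) (seq b n)

  identityʳⁱᵐ : ∀ a b →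
    a *ʳ ℚ⇒ℝ 0ℚ +ʳ b *ʳ ℚ⇒ℝ 1ℚ
    ≈ʳ b
  identityʳⁱᵐ a b = pointwise λ n → solve 2 (λ a b →
    a :* con 0ℚ :+ b :* con 1ℚ
    := b) refl
    (seq a n) (seq b n)

  distribˡʳᵉ : ∀ a b c d e f →
    a *ʳ (c +ʳ e) +ʳ -ʳ (b *ʳ (d +ʳ f))
    ≈ʳ (a *ʳ c +ʳ -ʳ (b *ʳ d)) +ʳ (a *ʳ e +ʳ -ʳ (b *ʳ f))
  distribˡʳᵉ a b c d e f = pointwise λ n → solve 6 (λ a b c d e f →
    a :* (c :+ e) :+ :- (b :* (d :+ f))
    := (a :* c :+ :- (b :* d)) :+ (a :* e :+ :- (b :* f))) refl
    (seq a n) (seq b n) (seq c n) (seq d n) (seq e n) (seq f n)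

  distribˡⁱᵐ : ∀ a b c d e f →
    a *ʳ (d +ʳ f) +ʳ b *ʳ (c +ʳ e)
    ≈ʳ (a *ʳ d +ʳ b *ʳ c) +ʳ (a *ʳ f +ʳ b *ʳ e)
  distribˡⁱᵐ a b c d e f = pointwise λ n → solve 6 (λ a b c d e f →
    a :* (d :+ f) :+ b :* (c :+ e)
    := (a :* d :+ b :* c) :+ (a :* f :+ b :* e)) refl
    (seq a n) (seq b n) (seq c n) (seq d n) (seq e n) (seq f n)

  distribʳʳᵉ : ∀ a b c d e f →
    (c +ʳ e) *ʳ a +ʳ -ʳ ((d +ʳ f) *ʳ b)
    ≈ʳ (c *ʳ a +ʳ -ʳ (d *ʳ b)) +ʳ (e *ʳ a +ʳ -ʳ (f *ʳ b))
  distribʳʳᵉ a b c d e f = pointwise λ n → solve 6 (λ a b c d e f →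
    (c :+ e) :* a :+ :- ((d :+ f) :* b)
    := (c :* a :+ :- (d :* b)) :+ (e :* a :+ :- (f :* b))) refl
    (seq a n) (seq b n) (seq c n) (seq d n) (seq e n) (seq f n)

  distribʳⁱᵐ : ∀ a b c d e f →
    (c +ʳ e) *ʳ b +ʳ (d +ʳ f) *ʳ a
    ≈ʳ (c *ʳ b +ʳ d *ʳ a) +ʳ (e *ʳ b +ʳ f *ʳ a)
  distribʳⁱᵐ a b c d e f = pointwise λ n → solve 6 (λ a b c d e f →
    (c :+ e) :* b :+ (d :+ f) :* a
    := (c :* b :+ d :* a) :+ (e :* b :+ f :* a)) refl
    (seq a n) (seq b n) (seq c n) (seq d n) (seq e n) (seq f n)

  commʳᵉ : ∀ a b c d →
    a *ʳ c +ʳ -ʳ (b *ʳ d)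
    ≈ʳ c *ʳ a +ʳ -ʳ (d *ʳ b)
  commʳᵉ a b c d = pointwise λ n → solve 4 (λ a b c d →
    a :* c :+ :- (b :* d)
    := c :* a :+ :- (d :* b)) refl
    (seq a n) (seq b n) (seq c n) (seq d n)

  commⁱᵐ : ∀ a b c d →
    a *ʳ d +ʳ b *ʳ c
    ≈ʳ c *ʳ b +ʳ d *ʳ a
  commⁱᵐ a b c d = pointwise λ n → solve 4 (λ a b c d →
    a :* d :+ b :* c
    := c :* b :+ d :* a) refl
    (seq a n) (seq b n) (seq c n) (seq d n)

ℂ-commutativeRing : CommutativeRing 0ℓ 0ℓ
ℂ-commutativeRing = record
  { Carrier = ℂ
  ; _≈_ = _≈ᶜ_
  ; _+_ = _+ᶜ_
  ; _*_ = _*ᶜ_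
  ; -_  = -ᶜ_
  ; 0#  = ℚ⇒ℂ 0ℚ
  ; 1#  = ℚ⇒ℂ 1ℚ
  ; isCommutativeRing = record
    { isRing = record
      { +-isAbelianGroup = record
        { isGroup = record
          { isMonoid = record
            { isSemigroup = record
              { isMagma = record
                { isEquivalence = record
                  { refl  = R.refl +i R.refl
                  ; sym   = λ p → R.sym (re≈ p) +i R.sym (im≈ p)
                  ; trans = λ p q → R.trans (re≈ p) (re≈ q) +i R.trans (im≈ p) (im≈ q)
                  }
                ; ∙-cong = λ p q → R.+-cong (re≈ p) (re≈ q) +i R.+-cong (im≈ p) (im≈ q)
                }
              ; assoc = λ x y z → R.+-assoc (re x) (re y) (re z) +i R.+-assoc (im x) (im y) (im z)
              }
            ; identity = (λ x → R.+-identityˡ (re x) +i R.+-identityˡ (im x))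
                       , (λ x → R.+-identityʳ (re x) +i R.+-identityʳ (im x))
            }
          ; inverse = (λ x → R.-‿inverseˡ (re x) +i R.-‿inverseˡ (im x))
                    , (λ x → R.-‿inverseʳ (re x) +i R.-‿inverseʳ (im x))
          ; ⁻¹-cong = λ p → R.-‿cong (re≈ p) +i R.-‿cong (im≈ p)
          }
        ; comm = λ x y → R.+-comm (re x) (re y) +i R.+-comm (im x) (im y)
        }
      ; *-cong = λ p q →
          R.+-cong (R.*-cong (re≈ p) (re≈ q)) (R.-‿cong (R.*-cong (im≈ p) (im≈ q)))
          +i R.+-cong (R.*-cong (re≈ p) (im≈ q)) (R.*-cong (im≈ p) (re≈ q))
      ; *-assoc = λ x y z →
          assocʳᵉ (re x) (im x) (re y) (im y) (re z) (im z)
          +i assocⁱᵐ (re x) (im x) (re y) (im y) (re z) (im z)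
      ; *-identity =
          (λ x →
            identityˡʳᵉ (re x) (im x)
            +i identityˡⁱᵐ (re x) (im x))
        , (λ x →
            identityʳʳᵉ (re x) (im x)
            +i identityʳⁱᵐ (re x) (im x))
      ; distrib =
          (λ x y z →
            distribˡʳᵉ (re x) (im x) (re y) (im y) (re z) (im z)
            +i distribˡⁱᵐ (re x) (im x) (re y) (im y) (re z) (im z))
        , (λ x y z →
            distribʳʳᵉ (re x) (im x) (re y) (im y) (re z) (im z)
            +i distribʳⁱᵐ (re x) (im x) (re y) (im y) (re z) (im z))
      }
    ; *-comm = λ x y →
        commʳᵉ (re x) (im x) (re y) (im y)
        +i commⁱᵐ (re x) (im x) (re y) (im y)
    }
  }

μ : (n : ℕ) → .{{NonZero n}} → ℤ
μ n = if does (unique? ℕ._≟_ ps) then -1ℤ ℤ.^ length ps else 0ℤ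
  where ps = factors (factorise n)

-- The constructions below only use rational scalars, so they are given over a
-- ring R with a map from ℚ, and instantiated at ℂ at the end.

module PowerSeries {c ℓ} (R : CommutativeRing c ℓ)
                   (fromℚ : ℚ → CommutativeRing.Carrier R) where

  open CommutativeRing R hiding (refl; zero)
  open import Algebra.Properties.Semiring.Sum semiring
    using (sum-syntax; sum⁺-syntax)

  fromℤ : ℤ → Carrier
  fromℤ k = fromℚ (k ℚ./ 1)

  fromℕ : ℕ → Carrier
  fromℕ n = fromℤ (+ n)

  1/_ : (n : ℕ) → .{{NonZero n}} → Carrier
  1/ n = fromℚ (1ℤ ℚ./ n)

  -- f n is the coefficient of xⁿ.
  Series : Set c
  Series = ℕ → Carrier

  infixr 8 _^ₛ_
  infix  8 -ₛ_
  infixl 7 _*ₛ_ _·_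
  infix  4 _⟶_ _≐∏_

  0ₛ 1ₛ : Series
  0ₛ _ = 0#
  1ₛ zero    = 1#
  1ₛ (suc _) = 0#

  X^_ : ℕ → Series
  (X^ m) n = if does (m ℕ.≟ n) then 1# else 0#

  -ₛ_ : Series → Series
  (-ₛ f) n = - f n

  _·_ : Carrier → Series → Series
  (a · f) n = a * f n

  _*ₛ_ : Series → Series → Series
  (f *ₛ h) n = ∑[ k ≤ n ] (f (toℕ k) * h (n ∸ toℕ k))

  _^ₛ_ : Series → ℕ → Series
  f ^ₛ zero  = 1ₛ
  f ^ₛ suc k = f *ₛ f ^ₛ k

  -- Convergence in the x-adic topology.
  _⟶_ : (ℕ → Series) → Series → Set ℓ
  s ⟶ f = ∀ k → ∃ λ N → ∀ M → N ℕ.≤ M → ∀ n → n ℕ.< k → s M n ≈ f n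

  -- The x-adic sum of f₀, f₁, f₂, … for families with fₖ divisible by xᵏ:
  -- the terms with k > n do not contribute to the coefficient of xⁿ.
  Σ∞ : (ℕ → Series) → Series
  Σ∞ f n = ∑[ k ≤ n ] f (toℕ k) n

  -- exp f = Σ fᵏ/k!, for f with zero constant coefficient.
  exp : Series → Series
  exp f = Σ∞ λ k → (1/ (k !)) {{k ℕ.!≢0}} · f ^ₛ k

  log[1-x^_] : (m : ℕ) → .{{NonZero m}} → Series
  log[1-x^ m ] = -ₛ Σ∞ λ where
    zero      → 0ₛ
    r@(suc _) → (1/ r) · X^ (m ℕ.* r)

  [1-x^_]^_ : (m : ℕ) → .{{NonZero m}} → Carrier → Series
  [1-x^ m ]^ β = exp (β · log[1-x^ m ])

  ∏≤ : ((m : ℕ) → .{{NonZero m}} → Series) → ℕ → Series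
  ∏≤ f zero    = 1ₛ
  ∏≤ f (suc M) = ∏≤ f M *ₛ f (suc M)

  -- F is the infinite product of the f m over m ≥ 1.
  _≐∏_ : Series → ((m : ℕ) → .{{NonZero m}} → Series) → Set ℓ
  F ≐∏ f = ∏≤ f ⟶ F

  Arith : Set c
  Arith = (n : ℕ) → .{{NonZero n}} → Carrier

  -- ∑∣ n t is the sum of t d (n / d) over the divisors d of n.
  ∑∣ : (n : ℕ) → .{{NonZero n}} →
       ((d e : ℕ) → .{{NonZero d}} → .{{NonZero e}} → Carrier) → Carrier
  ∑∣ n t = ∑[ i < n ] term (suc (toℕ i)) (suc (toℕ i) ∣? n)
    where
    term : (d : ℕ) → .{{NonZero d}} → Dec (d ∣ n) → Carrier
    term d {{d≢0}} (yes d∣n) = t d (quotient d∣n) {{d≢0}} {{quotient≢0 d∣n}}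
    term d         (no  _)   = 0#

  infixl 7 _⋆_

  _⋆_ : Arith → Arith → Arith
  (f ⋆ h) n = ∑∣ n λ d e → f d * h e

  μᴬ : Arith
  μᴬ n = fromℤ (μ n)

  bellTransform : Arith → Series
  bellTransform g = exp (-ₛ λ where
    zero      → 0#
    n@(suc _) → g n * 1/ n)

  bellExponent : Arith → Arith
  bellExponent g m = 1/ m * ∑∣ m λ d e → fromℤ (μ d) * g e

open PowerSeries ℂ-commutativeRing ℚ⇒ℂ public

{-# OPTIONS --safe #-}

-- Write θ = x d/dx.  From θ (exp f) = exp f · θ f and the product rule, both
-- F_g and the partial product over m ≤ M solve an equation θ F = F · a with
-- F(0) = 1, where a is θ of the corresponding exponent.  The coefficients of F
-- up to xᴹ are determined by those of a up to xᴹ, so it suffices to compare the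
-- latter.  In θ (Σ β(m) log (1 - xᵐ)) the coefficient of xⁿ is -Σ_{m ∣ n} m β(m),
-- which for m β(m) = (μ * g)(m) is -g(n) by Möbius inversion.

module Submission where

open import Algebra.Bundles using (CommutativeRing; module CommutativeRing)
open import Algebra.Morphism.Structures using (module RingMorphisms)
open import Data.Bool.Base using (true; false; if_then_else_)
open import Data.Fin.Base using (Fin; toℕ)
open import Data.Integer.Base as ℤ using (ℤ; +_; 0ℤ; 1ℤ; -1ℤ)
import Data.Integer.Properties as ℤ
import Data.Integer.Solver as ℤ-Solver
open import Data.List.Base using (List; []; _∷_; length)
open import Data.List.Membership.Propositional using (_∈_; _∉_)
open import Data.List.Relation.Binary.Permutation.Propositional using (_↭_; ↭-sym; ↭⇒↭ₛ)
open import Data.List.Relation.Binary.Permutation.Propositional.Properties using (↭-length)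
import Data.List.Relation.Binary.Permutation.Setoid.Properties as ↭ₛ
open import Data.List.Relation.Unary.All using (_∷_)
open import Data.List.Relation.Unary.All.Properties using (¬Any⇒All¬; All¬⇒¬Any)
open import Data.List.Relation.Unary.AllPairs using (_∷_)
open import Data.List.Relation.Unary.Unique.DecPropositional using (unique?)
open import Data.List.Relation.Unary.Unique.Propositional using (Unique)
open import Data.Nat.Base as ℕ using (ℕ; zero; suc; NonZero; NonTrivial; _∸_; _≤_; _<_; _!)
open import Data.Nat.Divisibility
  using (_∣_; _∤_; _∣?_; divides; m∣m*n; n∣m*n; ∣1⇒≡1; ∣⇒≤; ∣-trans; *-monoˡ-∣)
open import Data.Nat.ListAction using (product)
open import Data.Nat.ListAction.Properties using (∈⇒∣product)
open import Data.Nat.Primality using (Prime; euclidsLemma)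
open import Data.Nat.Primality.Factorisation
import Data.Nat.Properties as ℕ
open import Data.Product.Base using (_×_; _,_; ∃)
open import Data.Rational.Base as ℚ using (ℚ; 0ℚ; 1ℚ)
import Data.Rational.Properties as ℚ
import Data.Rational.Solver as ℚ-Solver
open import Data.Rational.Unnormalised.Base as ℚᵘ using (mkℚᵘ; *≡*)
import Data.Rational.Unnormalised.Properties as ℚᵘ
open import Data.Sum.Base using (inj₁; inj₂)
open import Defs using (μ; module PowerSeries)
open import Function.Base using (_∘_)
open import Function.Bundles using (_⇔_; mk⇔)
open import Relation.Binary.PropositionalEquality as ≡ using (_≡_; _≢_; cong; cong₂; subst)
open import Relation.Nullary.Decidable using (yes; no; does; does-⇔; dec-false)
open import Relation.Nullary.Negation using (contradiction)
open PrimeFactorisation using (isFactorisation; factorsPrime)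

-- The Möbius function

-- Two choices keep the argument elementary. Sums over divisors are replaced by sums over a fixed
-- box of pairs (i, j) weighted by a Kronecker delta. Commutativity and associativity of Dirichlet
-- convolution then come from interchanging finite sums, with no bijection between chains of
-- divisors. Any box bound N at least n gives the same value at n, so the number M of factors in the
-- partial product serves as one bound for all coefficients compared. The sum of μ over the divisors
-- of n > 1 is shown to vanish by fixing a single prime p of n and pairing e with p e, so all that
-- has to be known of μ is its value at p e. The equation θ F = F · a turns a product of
-- exponentials into a sum of exponents without the law exp (f + h) = exp f · exp h. Its recurrence
-- divides only by positive integers, and these are invertible in any ring `R` that receives ℚ
-- homomorphically. The analytic structure of ℂ therefore never enters.

signedRadical : List ℕ → ℤ
signedRadical ps = if does (unique? ℕ._≟_ ps) then -1ℤ ℤ.^ length ps else 0ℤ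

-- Prime factorisations are unique only up to order, so μ can be computed from any factorisation
-- once order is known not to matter.
signedRadical-↭ : ∀ {ps qs} → ps ↭ qs → signedRadical ps ≡ signedRadical qs
signedRadical-↭ {ps} {qs} ps↭qs = cong₂ (λ b k → if b then -1ℤ ℤ.^ k else 0ℤ)
  (does-⇔ (mk⇔ (resp ps↭qs) (resp (↭-sym ps↭qs))) (unique? ℕ._≟_ ps) (unique? ℕ._≟_ qs))
  (↭-length ps↭qs)
  where
  resp : ∀ {xs ys : List ℕ} → xs ↭ ys → Unique xs → Unique ys
  resp p = ↭ₛ.Unique-resp-↭ (≡.setoid ℕ) (↭⇒↭ₛ p)

signedRadical-∈ : ∀ {p ps} → p ∈ ps → signedRadical (p ∷ ps) ≡ 0ℤ
signedRadical-∈ {p} {ps} p∈ps = cong (λ b → if b then -1ℤ ℤ.^ length (p ∷ ps) else 0ℤ)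
  (dec-false (unique? ℕ._≟_ (p ∷ ps)) λ { (p∉ps ∷ _) → All¬⇒¬Any p∉ps p∈ps })

signedRadical-∉ : ∀ {p ps} → p ∉ ps → signedRadical (p ∷ ps) ≡ ℤ.- signedRadical ps
signedRadical-∉ {p} {ps} p∉ps = ≡.trans
  (cong (λ b → if b then -1ℤ ℤ.* -1ℤ ℤ.^ length ps else 0ℤ)
    (does-⇔ (mk⇔ (λ { (_ ∷ u) → u }) (¬Any⇒All¬ ps p∉ps ∷_))
      (unique? ℕ._≟_ (p ∷ ps)) (unique? ℕ._≟_ ps)))
  (negate (does (unique? ℕ._≟_ ps)))
  where
  negate : ∀ b → (if b then -1ℤ ℤ.* -1ℤ ℤ.^ length ps else 0ℤ)
                 ≡ ℤ.- (if b then -1ℤ ℤ.^ length ps else 0ℤ)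
  negate true  = ℤ.-1*i≡-i (-1ℤ ℤ.^ length ps)
  negate false = ≡.refl

prime∣⇒∈factors : ∀ {p n} (f : PrimeFactorisation n) → Prime p → p ∣ n → p ∈ factors f
prime∣⇒∈factors {p} f pp p∣n = factorisationHasAllPrimeFactors pp
  (subst (p ∣_) (isFactorisation f) p∣n) (factorsPrime f)

∈factors⇒∣ : ∀ {p n} (f : PrimeFactorisation n) → p ∈ factors f → p ∣ n
∈factors⇒∣ {p} f p∈ps = subst (p ∣_) (≡.sym (isFactorisation f)) (∈⇒∣product p∈ps)

-- Prepending p to the factors of e factorises p e; uniqueness identifies it with the computed
-- factorisation up to a permutation.
μ-prime* : ∀ {p} → Prime p → ∀ e .{{_ : NonZero e}} .{{_ : NonZero (p ℕ.* e)}} →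
           μ (p ℕ.* e) ≡ signedRadical (p ∷ factors (factorise e))
μ-prime* {p} pp e = signedRadical-↭ (factorisationUnique (factorise (p ℕ.* e)) record
  { factors         = p ∷ factors (factorise e)
  ; isFactorisation = cong (p ℕ.*_) (isFactorisation (factorise e))
  ; factorsPrime    = pp ∷ factorsPrime (factorise e)
  })

μ-prime*-∣ : ∀ {p} → Prime p → ∀ e .{{_ : NonZero e}} .{{_ : NonZero (p ℕ.* e)}} →
             p ∣ e → μ (p ℕ.* e) ≡ 0ℤ
μ-prime*-∣ pp e p∣e = ≡.trans (μ-prime* pp e)
  (signedRadical-∈ (prime∣⇒∈factors (factorise e) pp p∣e))

μ-prime*-∤ : ∀ {p} → Prime p → ∀ e .{{_ : NonZero e}} .{{_ : NonZero (p ℕ.* e)}} →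
             p ∤ e → μ (p ℕ.* e) ≡ ℤ.- μ e
μ-prime*-∤ pp e p∤e = ≡.trans (μ-prime* pp e)
  (signedRadical-∉ λ p∈ps → p∤e (∈factors⇒∣ (factorise e) p∈ps))

primeDivisor : ∀ n .{{_ : NonTrivial n}} → ∃ λ p → Prime p × p ∣ n
primeDivisor n@(ℕ.2+ _) = go (factorise n)
  where
  go : PrimeFactorisation n → ∃ λ p → Prime p × p ∣ n
  go record { factors = []     ; isFactorisation = () }
  go record { factors = p ∷ ps ; isFactorisation = n≡ ; factorsPrime = pp ∷ _ } =
    p , pp , subst (p ∣_) (≡.sym n≡) (m∣m*n (product ps))

-- Normalised fractions do not compute on variables. Identities between n/1 and 1/n are pulled back
-- to unnormalised fractions, where they become integer identities.
fromℚᵘ-+ : ∀ p q → ℚ.fromℚᵘ (p ℚᵘ.+ q) ≡ ℚ.fromℚᵘ p ℚ.+ ℚ.fromℚᵘ q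
fromℚᵘ-+ p q = ℚ.toℚᵘ-injective (ℚᵘ.≃-trans (ℚ.toℚᵘ-fromℚᵘ (p ℚᵘ.+ q)) (ℚᵘ.≃-sym
  (ℚᵘ.≃-trans (ℚ.toℚᵘ-homo-+ (ℚ.fromℚᵘ p) (ℚ.fromℚᵘ q))
    (ℚᵘ.+-cong (ℚ.toℚᵘ-fromℚᵘ p) (ℚ.toℚᵘ-fromℚᵘ q)))))

fromℚᵘ-* : ∀ p q → ℚ.fromℚᵘ (p ℚᵘ.* q) ≡ ℚ.fromℚᵘ p ℚ.* ℚ.fromℚᵘ q
fromℚᵘ-* p q = ℚ.toℚᵘ-injective (ℚᵘ.≃-trans (ℚ.toℚᵘ-fromℚᵘ (p ℚᵘ.* q)) (ℚᵘ.≃-sym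
  (ℚᵘ.≃-trans (ℚ.toℚᵘ-homo-* (ℚ.fromℚᵘ p) (ℚ.fromℚᵘ q))
    (ℚᵘ.*-cong (ℚ.toℚᵘ-fromℚᵘ p) (ℚ.toℚᵘ-fromℚᵘ q)))))

fromℚᵘ-neg : ∀ p → ℚ.fromℚᵘ (ℚᵘ.- p) ≡ ℚ.- ℚ.fromℚᵘ p
fromℚᵘ-neg p = ℚ.toℚᵘ-injective (ℚᵘ.≃-trans (ℚ.toℚᵘ-fromℚᵘ (ℚᵘ.- p)) (ℚᵘ.≃-sym
  (ℚᵘ.≃-trans (ℚ.toℚᵘ-homo‿- (ℚ.fromℚᵘ p)) (ℚᵘ.-‿cong (ℚ.toℚᵘ-fromℚᵘ p)))))

/1-+ : ∀ m n → (+ (m ℕ.+ n)) ℚ./ 1 ≡ ((+ m) ℚ./ 1) ℚ.+ ((+ n) ℚ./ 1)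
/1-+ m n = ≡.trans
  (ℚ.fromℚᵘ-cong {mkℚᵘ (+ (m ℕ.+ n)) 0} {mkℚᵘ (+ m) 0 ℚᵘ.+ mkℚᵘ (+ n) 0} (*≡*
    (solve 2 (λ a b → (a :+ b) :* con 1ℤ := (a :* con 1ℤ :+ b :* con 1ℤ) :* con 1ℤ) ≡.refl (+ m) (+ n))))
  (fromℚᵘ-+ (mkℚᵘ (+ m) 0) (mkℚᵘ (+ n) 0))
  where open ℤ-Solver.+-*-Solver

/1-* : ∀ m n → (+ (m ℕ.* n)) ℚ./ 1 ≡ ((+ m) ℚ./ 1) ℚ.* ((+ n) ℚ./ 1)
/1-* m n = ≡.trans (cong (ℚ._/ 1) (ℤ.pos-* m n)) (fromℚᵘ-* (mkℚᵘ (+ m) 0) (mkℚᵘ (+ n) 0))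

n/1*1/n≡1 : ∀ n .{{_ : NonZero n}} → ((+ n) ℚ./ 1) ℚ.* (1ℤ ℚ./ n) ≡ 1ℚ
n/1*1/n≡1 n@(suc n-1) = ≡.trans
  (≡.sym (fromℚᵘ-* (mkℚᵘ (+ n) 0) (mkℚᵘ 1ℤ n-1)))
  (ℚ.fromℚᵘ-cong {mkℚᵘ (+ n) 0 ℚᵘ.* mkℚᵘ 1ℤ n-1} {ℚᵘ.1ℚᵘ} (*≡*
    (solve 1 (λ a → a :* con 1ℤ :* con 1ℤ := con 1ℤ :* (con 1ℤ :* a)) ≡.refl (+ n))))
  where open ℤ-Solver.+-*-Solver

module EulerProduct {c ℓ} (R : CommutativeRing c ℓ) (fromℚ : ℚ → CommutativeRing.Carrier R)
  (fromℚ-homo : RingMorphisms.IsRingHomomorphism ℚ.+-*-rawRing (CommutativeRing.rawRing R) fromℚ)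
  where

  open CommutativeRing R hiding (zero)
  open PowerSeries R fromℚ
  open RingMorphisms.IsRingHomomorphism fromℚ-homo
    using (+-homo; *-homo; -‿homo; 0#-homo; 1#-homo)
  open import Algebra.Properties.Ring ring
    using (+-cancelˡ; -0#≈0#; -‿distribˡ-*; -‿distribʳ-*; -‿+-comm)
  open import Algebra.Properties.Semiring.Sum semiring using (sum; sum-cong-≋)
  open import Algebra.Solver.Ring.NaturalCoefficients.Default commutativeSemiring
    using (solve; _:=_; _:+_; _:*_; con)
  open import Relation.Binary.Reasoning.Setoid setoid

  -- Finite sums, opaque so that unification can infer the summand.

  opaque
    ∑ : ℕ → (ℕ → Carrier) → Carrier
    ∑ zero    f = 0#
    ∑ (suc n) f = f 0 + ∑ n (λ i → f (suc i))

    ∑-0 : ∀ {f} → ∑ 0 f ≈ 0#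
    ∑-0 = refl

    ∑-suc : ∀ n {f} → ∑ (suc n) f ≈ f 0 + ∑ n (λ i → f (suc i))
    ∑-suc n = refl

    sum≈∑ : ∀ n f → sum {n} (λ i → f (toℕ i)) ≈ ∑ n f
    sum≈∑ zero    f = refl
    sum≈∑ (suc n) f = +-congˡ (sum≈∑ n (λ i → f (suc i)))

    ∑-cong< : ∀ n {f h} → (∀ i → i < n → f i ≈ h i) → ∑ n f ≈ ∑ n h
    ∑-cong< zero    f≈h = refl
    ∑-cong< (suc n) f≈h = +-cong (f≈h 0 ℕ.z<s) (∑-cong< n λ i i<n → f≈h (suc i) (ℕ.s<s i<n))

    ∑-cong : ∀ n {f h} → (∀ i → f i ≈ h i) → ∑ n f ≈ ∑ n h
    ∑-cong n f≈h = ∑-cong< n λ i _ → f≈h i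

    ∑-+ : ∀ n {f h} → (∑ n λ i → f i + h i) ≈ ∑ n f + ∑ n h
    ∑-+ zero    = sym (+-identityˡ 0#)
    ∑-+ (suc n) = trans (+-congˡ (∑-+ n))
      (solve 4 (λ a b c d → (a :+ b) :+ (c :+ d) := (a :+ c) :+ (b :+ d)) refl _ _ _ _)

    ∑-*ˡ : ∀ n {x f} → x * ∑ n f ≈ ∑ n λ i → x * f i
    ∑-*ˡ zero    = zeroʳ _
    ∑-*ˡ (suc n) = trans (distribˡ _ _ _) (+-congˡ (∑-*ˡ n))

    ∑-*ʳ : ∀ n {x f} → ∑ n f * x ≈ ∑ n λ i → f i * x
    ∑-*ʳ zero    = zeroˡ _
    ∑-*ʳ (suc n) = trans (distribʳ _ _ _) (+-congˡ (∑-*ʳ n))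

    ∑-last : ∀ n {f} → ∑ (suc n) f ≈ ∑ n f + f n
    ∑-last zero    = +-comm _ 0#
    ∑-last (suc n) = trans (+-congˡ (∑-last n)) (sym (+-assoc _ _ _))

    ∑-zero : ∀ n {f} → (∀ i → i < n → f i ≈ 0#) → ∑ n f ≈ 0#
    ∑-zero zero    f≈0 = refl
    ∑-zero (suc n) f≈0 = trans
      (+-cong (f≈0 0 ℕ.z<s) (∑-zero n λ i i<n → f≈0 (suc i) (ℕ.s<s i<n)))
      (+-identityˡ 0#)

    ∑-swap : ∀ m n {f : ℕ → ℕ → Carrier} →
             (∑ m λ i → ∑ n λ j → f i j) ≈ ∑ n λ j → ∑ m λ i → f i j
    ∑-swap zero    n = sym (∑-zero n λ _ _ → refl)
    ∑-swap (suc m) n = trans (+-congˡ (∑-swap m n)) (sym (∑-+ n))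

    ∑-neg : ∀ n {f} → (∑ n λ i → - f i) ≈ - ∑ n f
    ∑-neg zero    = sym -0#≈0#
    ∑-neg (suc n) = trans (+-congˡ (∑-neg n)) (-‿+-comm _ _)

    ∑-extend : ∀ {m n} → m ≤ n → ∀ {f} → (∀ i → m ≤ i → f i ≈ 0#) → ∑ n f ≈ ∑ m f
    ∑-extend {n = n} ℕ.z≤n       f≈0 = ∑-zero n λ i _ → f≈0 i ℕ.z≤n
    ∑-extend         (ℕ.s≤s m≤n) f≈0 = +-congˡ (∑-extend m≤n λ i m≤i → f≈0 (suc i) (ℕ.s≤s m≤i))

    ∑-single : ∀ {n a} → a < n → ∀ {f} → (∀ i → i ≢ a → f i ≈ 0#) → ∑ n f ≈ f a
    ∑-single {suc n} {zero}  _         f≈0 = trans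
      (+-congˡ (∑-zero n λ i _ → f≈0 (suc i) λ ())) (+-identityʳ _)
    ∑-single {suc n} {suc a} (ℕ.s<s a<n) f≈0 = trans
      (+-cong (f≈0 0 λ ()) (∑-single a<n λ i i≢a → f≈0 (suc i) (i≢a ∘ ℕ.suc-injective)))
      (+-identityˡ _)

  -- Kronecker delta. Successors on both sides cancel by computation, which silently converts
  -- between a number and its index, one less.
  δ : ℕ → ℕ → Carrier
  δ zero    zero    = 1#
  δ zero    (suc n) = 0#
  δ (suc m) zero    = 0#
  δ (suc m) (suc n) = δ m n

  X^-δ : ∀ m n → (X^ m) n ≡ δ m n
  X^-δ zero    zero    = ≡.refl
  X^-δ zero    (suc n) = ≡.refl
  X^-δ (suc m) zero    = ≡.refl
  X^-δ (suc m) (suc n) = X^-δ m n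

  δ-≡ : ∀ {m n} → m ≡ n → δ m n ≈ 1#
  δ-≡ {zero}  ≡.refl = refl
  δ-≡ {suc m} ≡.refl = δ-≡ {m} ≡.refl

  δ-≢ : ∀ {m n} → m ≢ n → δ m n ≈ 0#
  δ-≢ {zero}  {zero}  m≢n = contradiction ≡.refl m≢n
  δ-≢ {zero}  {suc n} m≢n = refl
  δ-≢ {suc m} {zero}  m≢n = refl
  δ-≢ {suc m} {suc n} m≢n = δ-≢ {m} (m≢n ∘ cong suc)

  δ*-≡ : ∀ {m n} x → m ≡ n → δ m n * x ≈ x
  δ*-≡ x m≡n = trans (*-congʳ (δ-≡ m≡n)) (*-identityˡ x)

  δ*-≢ : ∀ {m n} x → m ≢ n → δ m n * x ≈ 0#
  δ*-≢ x m≢n = trans (*-congʳ (δ-≢ m≢n)) (zeroˡ x)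

  ∑-δ : ∀ {n a} → a < n → ∀ (f : ℕ → Carrier) → (∑ n λ i → δ a i * f i) ≈ f a
  ∑-δ {a = a} a<n f = trans
    (∑-single a<n λ i i≢a → δ*-≢ (f i) (i≢a ∘ ≡.sym))
    (δ*-≡ {a} (f a) ≡.refl)

  ∑-δ-≥ : ∀ {n a} → n ≤ a → ∀ (f : ℕ → Carrier) → (∑ n λ i → δ a i * f i) ≈ 0#
  ∑-δ-≥ {n} n≤a f = ∑-zero n λ i i<n → δ*-≢ (f i) (ℕ.<⇒≢ (ℕ.<-≤-trans i<n n≤a) ∘ ≡.sym)

  -- Dirichlet convolution

  -- The convolution at n for n ≤ N, where the entry of index i of f or h is the
  -- value at suc i.
  conv : ℕ → (f h : ℕ → Carrier) → ℕ → Carrier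
  conv N f h n = ∑ N λ i → ∑ N λ j → δ (suc i ℕ.* suc j) n * (f i * h j)

  *≢-≥ : ∀ {i j n N} → n ≤ N → N ≤ i → suc i ℕ.* suc j ≢ n
  *≢-≥ {i} {j} n≤N N≤i = ℕ.>⇒≢ (ℕ.<-≤-trans
    (ℕ.≤-<-trans (ℕ.≤-trans n≤N N≤i) (ℕ.n<1+n i)) (ℕ.m≤m*n (suc i) (suc j)))

  -- The left-hand side of divisor-term involves a function local to ∑∣, which
  -- has no name here; it is left to be inferred from the use in ⋆-conv.
  mutual
    ⋆-conv : ∀ f h {n N} .{{n≢0 : NonZero n}} → n ≤ N →
             (f ⋆ h) n ≈ conv N (λ i → f (suc i)) (λ j → h (suc j)) n
    ⋆-conv f h {n} {N} {{n≢0}} n≤N = trans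
      (sum-cong-≋ {n} λ i → divisor-term f h n N {{n≢0}} n≤N i)
      -- Rows with i ≥ n are empty, since i + 1 > n is no factor of n.
      (trans (sum≈∑ n _) (sym (∑-extend n≤N λ i n≤i → ∑-zero N λ j _ → δ*-≢ _ (*≢-≥ ℕ.≤-refl n≤i))))

    divisor-term : ∀ f h n N .{{_ : NonZero n}} → n ≤ N → (i : Fin n) →
      _ ≈ ∑ N λ j → δ (suc (toℕ i) ℕ.* suc j) n * (f (suc (toℕ i)) * h (suc j))
    divisor-term f h n N n≤N i with suc (toℕ i) ∣? n
    ... | yes (divides zero n≡0) = contradiction n≡0 (ℕ.≢-nonZero⁻¹ n)
    -- A divisor meets its row of the box once, at the index q of its cofactor q + 1.
    ... | yes (divides (suc q) n≡) = sym (trans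
      (∑-single (ℕ.<-≤-trans q<n n≤N) λ j j≢q → δ*-≢ (f (suc (toℕ i)) * h (suc j)) λ eq → j≢q
        (ℕ.suc-injective (ℕ.*-cancelˡ-≡ (suc j) (suc q) (suc (toℕ i)) (≡.trans eq n≡′))))
      (δ*-≡ _ (≡.sym n≡′)))
      where
      n≡′ : n ≡ suc (toℕ i) ℕ.* suc q
      n≡′ = ≡.trans n≡ (ℕ.*-comm (suc q) (suc (toℕ i)))
      q<n : q < n
      q<n = subst (suc q ≤_) (≡.sym n≡) (ℕ.m≤m*n (suc q) (suc (toℕ i)))
    ... | no i∤n = sym (∑-zero N λ j _ → δ*-≢ _ λ eq →
      i∤n (subst (suc (toℕ i) ∣_) eq (m∣m*n (suc j))))

  conv-cong : ∀ N n {f f′ h} → (∀ i → i < N → f i ≈ f′ i) → conv N f h n ≈ conv N f′ h n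
  conv-cong N n f≈f′ = ∑-cong< N λ i i<N → ∑-cong N λ j → *-congˡ (*-congʳ (f≈f′ i i<N))

  conv-comm : ∀ N n {f h} → conv N f h n ≈ conv N h f n
  conv-comm N n = trans (∑-swap N N) (∑-cong N λ j → ∑-cong N λ i → *-cong
    (reflexive (cong (λ k → δ k n) (ℕ.*-comm (suc i) (suc j)))) (*-comm _ _))

  conv₃ : ℕ → (f g h : ℕ → Carrier) → ℕ → Carrier
  conv₃ N f g h n = ∑ N λ i → ∑ N λ j → ∑ N λ k →
    δ (suc i ℕ.* suc j ℕ.* suc k) n * (f i * g j * h k)

  -- With this rotation and commutativity, associativity needs only the left-nested bracket to be
  -- expanded.
  conv₃-rotate : ∀ N n {f g h} → conv₃ N f g h n ≈ conv₃ N g h f n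
  conv₃-rotate N n = trans (∑-swap N N) (∑-cong N λ j → trans (∑-swap N N)
    (∑-cong N λ k → ∑-cong N λ i → *-cong
      (reflexive (cong (λ m → δ m n) (≡.trans
        (ℕ.*-assoc (suc i) (suc j) (suc k)) (ℕ.*-comm (suc i) (suc j ℕ.* suc k)))))
      (solve 3 (λ a b c → a :* b :* c := b :* c :* a) refl _ _ _)))

  -- The sum over m collapses at m + 1 = (i + 1)(j + 1). If that product exceeds N, no m matches,
  -- but its multiple by k + 1 then exceeds n, so the term of `conv₃` vanishes too.
  conv-convˡ : ∀ {N n} → n ≤ N → ∀ {f g h} →
               conv N (λ m → conv N f g (suc m)) h n ≈ conv₃ N f g h n
  conv-convˡ {N} {n} n≤N {f} {g} {h} = begin
    (∑ N λ m → ∑ N λ k → δ (suc m ℕ.* suc k) n * (conv N f g (suc m) * h k))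
      ≈⟨ ∑-cong N (λ m → ∑-cong N λ k → push m k) ⟩
    (∑ N λ m → ∑ N λ k → ∑ N λ i → ∑ N λ j → t i j k m)
      ≈⟨ ∑-cong N (λ m → ∑-swap N N) ⟩
    (∑ N λ m → ∑ N λ i → ∑ N λ k → ∑ N λ j → t i j k m)
      ≈⟨ ∑-swap N N ⟩
    (∑ N λ i → ∑ N λ m → ∑ N λ k → ∑ N λ j → t i j k m)
      ≈⟨ ∑-cong N (λ i → ∑-cong N λ m → ∑-swap N N) ⟩
    (∑ N λ i → ∑ N λ m → ∑ N λ j → ∑ N λ k → t i j k m)
      ≈⟨ ∑-cong N (λ i → ∑-swap N N) ⟩
    (∑ N λ i → ∑ N λ j → ∑ N λ m → ∑ N λ k → t i j k m)
      ≈⟨ ∑-cong N (λ i → ∑-cong N λ j → ∑-swap N N) ⟩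
    (∑ N λ i → ∑ N λ j → ∑ N λ k → ∑ N λ m → t i j k m)
      -- `j + i * suc j` is the predecessor of `suc i * suc j`.
      ≈⟨ ∑-cong N (λ i → ∑-cong N λ j → ∑-cong N λ k → collapse (j ℕ.+ i ℕ.* suc j) k) ⟩
    conv₃ N f g h n ∎
    where
    t : ℕ → ℕ → ℕ → ℕ → Carrier
    t i j k m = δ (suc i ℕ.* suc j) (suc m) * (δ (suc m ℕ.* suc k) n * (f i * g j * h k))

    push : ∀ m k → δ (suc m ℕ.* suc k) n * (conv N f g (suc m) * h k)
                   ≈ ∑ N λ i → ∑ N λ j → t i j k m
    push m k = trans (*-congˡ (∑-*ʳ N)) (trans (∑-*ˡ N) (∑-cong N λ i →
      trans (*-congˡ (∑-*ʳ N)) (trans (∑-*ˡ N) (∑-cong N λ j →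
        solve 4 (λ a b c d → a :* (b :* c :* d) := b :* (a :* (c :* d))) refl _ _ (f i * g j) (h k)))))

    collapse : ∀ a k {x} → (∑ N λ m → δ a m * (δ (suc m ℕ.* suc k) n * x))
                           ≈ δ (suc a ℕ.* suc k) n * x
    collapse a k {x} with a ℕ.<? N
    ... | yes a<N = ∑-δ a<N λ m → δ (suc m ℕ.* suc k) n * x
    ... | no  a≮N = trans (∑-δ-≥ (ℕ.≮⇒≥ a≮N) λ m → δ (suc m ℕ.* suc k) n * x)
                          (sym (δ*-≢ x (*≢-≥ {a} {k} n≤N (ℕ.≮⇒≥ a≮N))))

  conv-assoc : ∀ {N n} → n ≤ N → ∀ {f g h} →
               conv N (λ m → conv N f g (suc m)) h n ≈ conv N f (λ m → conv N g h (suc m)) n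
  conv-assoc {N} {n} n≤N {f} {g} {h} = begin
    conv N (λ m → conv N f g (suc m)) h n  ≈⟨ conv-convˡ n≤N ⟩
    conv₃ N f g h n                        ≈⟨ conv₃-rotate N n ⟩
    conv₃ N g h f n                        ≈⟨ conv-convˡ n≤N ⟨
    conv N (λ m → conv N g h (suc m)) f n  ≈⟨ conv-comm N n ⟩
    conv N f (λ m → conv N g h (suc m)) n  ∎

  -- Divisor sums of μ, with divisibility written as a sum of Kronecker deltas

  divides-indicator : ℕ → ℕ → ℕ → Carrier
  divides-indicator N d n = ∑ N λ j → δ (d ℕ.* suc j) n

  divides-indicator-∣ : ∀ {N d n} .{{_ : NonZero d}} .{{_ : NonZero n}} → n ≤ N → d ∣ n →
                        divides-indicator N d n ≈ 1#
  divides-indicator-∣ {n = n} n≤N (divides zero n≡0) = contradiction n≡0 (ℕ.≢-nonZero⁻¹ n)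
  divides-indicator-∣ {N} {d} n≤N (divides (suc q) n≡) = trans
    (∑-single (ℕ.<-≤-trans (subst (suc q ≤_) (≡.sym n≡) (ℕ.m≤m*n (suc q) d)) n≤N)
      λ j j≢q → δ-≢ λ eq → j≢q (ℕ.suc-injective (ℕ.*-cancelˡ-≡ (suc j) (suc q) d (≡.trans eq n≡′))))
    (δ-≡ (≡.sym n≡′))
    where n≡′ = ≡.trans n≡ (ℕ.*-comm (suc q) d)

  divides-indicator-∤ : ∀ {N d n} → d ∤ n → divides-indicator N d n ≈ 0#
  divides-indicator-∤ {N} {d} d∤n = ∑-zero N λ j _ → δ-≢ λ eq →
    d∤n (subst (d ∣_) eq (m∣m*n (suc j)))

  fromℤ-1 : fromℤ 1ℤ ≈ 1#
  fromℤ-1 = 1#-homo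

  fromℤ-0 : fromℤ 0ℤ ≈ 0#
  fromℤ-0 = 0#-homo

  fromℤ-neg : ∀ k → fromℤ (ℤ.- k) ≈ - fromℤ k
  fromℤ-neg k = trans (reflexive (cong fromℚ (fromℚᵘ-neg (mkℚᵘ k 0)))) (-‿homo (k ℚ./ 1))

  fromℕ-+ : ∀ m n → fromℕ (m ℕ.+ n) ≈ fromℕ m + fromℕ n
  fromℕ-+ m n = trans (reflexive (cong fromℚ (/1-+ m n))) (+-homo _ _)

  fromℕ-* : ∀ m n → fromℕ (m ℕ.* n) ≈ fromℕ m * fromℕ n
  fromℕ-* m n = trans (reflexive (cong fromℚ (/1-* m n))) (*-homo _ _)

  fromℕ-inverse : ∀ n .{{_ : NonZero n}} → fromℕ n * 1/ n ≈ 1#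
  fromℕ-inverse n = trans (sym (*-homo _ _)) (trans (reflexive (cong fromℚ (n/1*1/n≡1 n))) 1#-homo)

  μ-term : ℕ → ℕ → ℕ → Carrier
  μ-term N n i = μᴬ (suc i) * divides-indicator N (suc i) n

  μ-term-∤ : ∀ {N n i} → suc i ∤ n → μ-term N n i ≈ 0#
  μ-term-∤ {N} i∤n = trans (*-congˡ (divides-indicator-∤ {N} i∤n)) (zeroʳ _)

  -- Among the divisors of n, the squarefree multiples p e of a prime p ∣ n
  -- cancel against the divisors e prime to p.
  μ-term-prime : ∀ {p N n} → Prime (suc p) → .{{_ : NonZero n}} → n ≤ N → suc p ∣ n →
    ∀ e → e < N → μ-term N n (e ℕ.+ p ℕ.* suc e) + μ-term N n e
                  ≈ divides-indicator N (suc p) (suc e) * μ-term N n e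
  μ-term-prime {p} {N} {n} pp n≤N p∣n e e<N with suc p ∣? suc e
  ... | yes p∣e = begin
    μᴬ (suc p ℕ.* suc e) * _ + μ-term N n e
      ≈⟨ +-congʳ (trans
           (*-congʳ (trans (reflexive (cong fromℤ (μ-prime*-∣ pp (suc e) p∣e))) fromℤ-0))
           (zeroˡ _)) ⟩
    0# + μ-term N n e
      ≈⟨ +-identityˡ _ ⟩
    μ-term N n e
      ≈⟨ *-identityˡ _ ⟨
    1# * μ-term N n e
      ≈⟨ *-congʳ (divides-indicator-∣ e<N p∣e) ⟨
    divides-indicator N (suc p) (suc e) * μ-term N n e ∎
  ... | no p∤e = begin
    μᴬ (suc p ℕ.* suc e) * divides-indicator N (suc p ℕ.* suc e) n + μ-term N n e
      ≈⟨ +-congʳ (*-cong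
           (trans (reflexive (cong fromℤ (μ-prime*-∤ pp (suc e) p∤e))) (fromℤ-neg (μ (suc e))))
           same) ⟩
    - μᴬ (suc e) * divides-indicator N (suc e) n + μ-term N n e
      ≈⟨ +-congʳ (-‿distribˡ-* _ _) ⟨
    - μ-term N n e + μ-term N n e
      ≈⟨ -‿inverseˡ _ ⟩
    0#
      ≈⟨ zeroˡ _ ⟨
    0# * μ-term N n e
      ≈⟨ *-congʳ (divides-indicator-∤ {N} p∤e) ⟨
    divides-indicator N (suc p) (suc e) * μ-term N n e ∎
    where
    same : divides-indicator N (suc p ℕ.* suc e) n ≈ divides-indicator N (suc e) n
    same with suc e ∣? n
    ... | no  e∤n = trans
      (divides-indicator-∤ {N} λ pe∣n → e∤n (∣-trans (n∣m*n (suc p)) pe∣n))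
      (sym (divides-indicator-∤ {N} e∤n))
    ... | yes e∣n@(divides q n≡) = trans
      (divides-indicator-∣ n≤N pe∣n)
      (sym (divides-indicator-∣ n≤N e∣n))
      where
      pe∣n : suc p ℕ.* suc e ∣ n
      -- The prime divides n, which is q times `suc e`, and not the second factor, so it divides q.
      pe∣n with euclidsLemma q (suc e) pp (subst (suc p ∣_) n≡ p∣n)
      ... | inj₁ p∣q = subst (suc p ℕ.* suc e ∣_) (≡.sym n≡) (*-monoˡ-∣ (suc e) p∣q)
      ... | inj₂ p∣e = contradiction p∣e p∤e

  -- For n > 1, `μ-term-prime` is summed over e for one prime divisor of n. Regrouped by multiples
  -- of that prime, its right side is again `∑ N multiples`; cancelling this sum leaves 0.
  ∑-μ-term : ∀ {N} n .{{_ : NonZero n}} → n ≤ N → ∑ N (μ-term N n) ≈ δ 1 n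
  ∑-μ-term {N} 1 1≤N = begin
    ∑ N (μ-term N 1)
      ≈⟨ ∑-single 1≤N (λ i i≢0 → μ-term-∤ {N} (i≢0 ∘ ℕ.suc-injective ∘ ∣1⇒≡1)) ⟩
    μᴬ 1 * divides-indicator N 1 1
      ≈⟨ *-cong fromℤ-1 (divides-indicator-∣ 1≤N (m∣m*n 1)) ⟩
    1# * 1#
      ≈⟨ *-identityˡ 1# ⟩
    1# ∎
  ∑-μ-term {N} n@(ℕ.2+ _) n≤N with primeDivisor n
  ... | suc p , pp , p∣n = +-cancelˡ (∑ N multiples) _ _ (begin
    ∑ N multiples + ∑ N (μ-term N n)
      ≈⟨ ∑-+ N ⟨
    (∑ N λ e → multiples e + μ-term N n e)
      ≈⟨ ∑-cong< N (μ-term-prime pp n≤N p∣n) ⟩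
    (∑ N λ i → divides-indicator N (suc p) (suc i) * μ-term N n i)
      ≈⟨ ∑-cong N (λ i → ∑-*ʳ N) ⟩
    (∑ N λ i → ∑ N λ e → δ (suc p ℕ.* suc e) (suc i) * μ-term N n i)
      ≈⟨ ∑-swap N N ⟩
    (∑ N λ e → ∑ N λ i → δ (e ℕ.+ p ℕ.* suc e) i * μ-term N n i)
      ≈⟨ ∑-cong N (λ e → evaluate (e ℕ.+ p ℕ.* suc e)) ⟩
    ∑ N multiples
      ≈⟨ +-identityʳ _ ⟨
    ∑ N multiples + 0# ∎)
    where
    multiples : ℕ → Carrier
    multiples e = μ-term N n (e ℕ.+ p ℕ.* suc e)

    evaluate : ∀ a → (∑ N λ i → δ a i * μ-term N n i) ≈ μ-term N n a
    -- An index a ≥ N stands for a number above n, which does not divide n, so clipping the range at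
    -- N loses nothing.
    evaluate a with a ℕ.<? N
    ... | yes a<N = ∑-δ a<N (μ-term N n)
    ... | no  a≮N = trans (∑-δ-≥ (ℕ.≮⇒≥ a≮N) (μ-term N n)) (sym (μ-term-∤ {N} λ a∣n →
      a≮N (ℕ.≤-trans (∣⇒≤ a∣n) n≤N)))

  -- Möbius inversion

  one : ℕ → Carrier
  one _ = 1#

  conv-μ-1 : ∀ {N} n .{{_ : NonZero n}} → n ≤ N → conv N (λ i → μᴬ (suc i)) one n ≈ δ 1 n
  conv-μ-1 {N} n n≤N = trans
    (∑-cong N λ i → trans
      (∑-cong N λ j → solve 2 (λ a b → a :* (b :* con 1) := b :* a) refl _ (μᴬ (suc i)))
      (sym (∑-*ˡ N)))
    (∑-μ-term n n≤N)

  möbius-inversion : ∀ {N n} → n < N → ∀ g →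
    conv N (λ m → conv N (λ i → μᴬ (suc i)) g (suc m)) one (suc n) ≈ g n
  möbius-inversion {N} {n} n<N g = begin
    conv N (λ m → conv N M g (suc m)) one (suc n)    ≈⟨ conv-cong N (suc n) (λ m _ → conv-comm N (suc m)) ⟩
    conv N (λ m → conv N g M (suc m)) one (suc n)    ≈⟨ conv-assoc n<N ⟩
    conv N g (λ m → conv N M one (suc m)) (suc n)    ≈⟨ conv-comm N (suc n) ⟩
    conv N (λ m → conv N M one (suc m)) g (suc n)    ≈⟨ conv-cong N (suc n) (λ m m<N → conv-μ-1 (suc m) m<N) ⟩
    -- `δ 0` is the unit of Dirichlet convolution, its index 0 standing for the number 1.
    conv N (δ 0) g (suc n)
      ≈⟨ ∑-single {N} {0} (ℕ.≤-<-trans ℕ.z≤n n<N) (λ i i≢0 → ∑-zero N λ j _ → trans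
           (*-congˡ (δ*-≢ (g j) (i≢0 ∘ ≡.sym))) (zeroʳ _)) ⟩
    (∑ N λ j → δ (j ℕ.+ 0) n * (1# * g j))
      ≈⟨ ∑-single n<N (λ j j≢n → δ*-≢ (1# * g j) (j≢n ∘ ≡.trans (≡.sym (ℕ.+-identityʳ j)))) ⟩
    δ (n ℕ.+ 0) n * (1# * g n)
      ≈⟨ δ*-≡ _ (ℕ.+-identityʳ n) ⟩
    1# * g n
      ≈⟨ *-identityˡ (g n) ⟩
    g n ∎
    where
    M : ℕ → Carrier
    M i = μᴬ (suc i)

  -- Power series

  tail : Series → Series
  tail f n = f (suc n)

  infixl 6 _+ₛ_

  _+ₛ_ : Series → Series → Series
  (f +ₛ h) n = f n + h n

  *ₛ-∑ : ∀ f h n → (f *ₛ h) n ≈ ∑ (suc n) λ k → f k * h (n ∸ k)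
  *ₛ-∑ f h n = sum≈∑ (suc n) λ k → f k * h (n ∸ k)

  *ₛ-cong : ∀ f f′ h h′ n → (∀ k → k ≤ n → f k ≈ f′ k) → (∀ k → k ≤ n → h k ≈ h′ k) →
            (f *ₛ h) n ≈ (f′ *ₛ h′) n
  *ₛ-cong f f′ h h′ n f≈f′ h≈h′ = begin
    (f *ₛ h) n                           ≈⟨ *ₛ-∑ f h n ⟩
    (∑ (suc n) λ k → f k * h (n ∸ k))    ≈⟨ ∑-cong< (suc n) (λ k k≤n →
                                              *-cong (f≈f′ k (ℕ.s≤s⁻¹ k≤n)) (h≈h′ (n ∸ k) (ℕ.m∸n≤m n k))) ⟩
    (∑ (suc n) λ k → f′ k * h′ (n ∸ k))  ≈⟨ *ₛ-∑ f′ h′ n ⟨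
    (f′ *ₛ h′) n                         ∎

  *ₛ-congˡ : ∀ f {h h′} n → (∀ k → h k ≈ h′ k) → (f *ₛ h) n ≈ (f *ₛ h′) n
  *ₛ-congˡ f n h≈h′ = *ₛ-cong f f _ _ n (λ _ _ → refl) λ k _ → h≈h′ k

  *ₛ-congʳ : ∀ h {f f′} n → (∀ k → f k ≈ f′ k) → (f *ₛ h) n ≈ (f′ *ₛ h) n
  *ₛ-congʳ h n f≈f′ = *ₛ-cong _ _ h h n (λ k _ → f≈f′ k) λ _ _ → refl

  -- By computation the Cauchy product splits only at `f 0`. This split at the other end drives
  -- commutativity and the recurrence for logarithmic derivatives.
  *ₛ-sucʳ : ∀ f h n → (f *ₛ h) (suc n) ≈ (f *ₛ tail h) n + f (suc n) * h 0
  *ₛ-sucʳ f h zero    = solve 2 (λ a b → a :+ (b :+ con 0) := a :+ con 0 :+ b) refl _ _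
  *ₛ-sucʳ f h (suc n) = trans (+-congˡ (*ₛ-sucʳ (tail f) h n)) (sym (+-assoc _ _ _))

  *ₛ-comm : ∀ f h n → (f *ₛ h) n ≈ (h *ₛ f) n
  *ₛ-comm f h zero    = +-congʳ (*-comm (f 0) (h 0))
  *ₛ-comm f h (suc n) = begin
    f 0 * h (suc n) + (tail f *ₛ h) n  ≈⟨ +-cong (*-comm _ _) (*ₛ-comm (tail f) h n) ⟩
    h (suc n) * f 0 + (h *ₛ tail f) n  ≈⟨ +-comm _ _ ⟩
    (h *ₛ tail f) n + h (suc n) * f 0  ≈⟨ *ₛ-sucʳ h f n ⟨
    (h *ₛ f) (suc n)                   ∎

  *ₛ-distribʳ : ∀ f g h n → ((f +ₛ g) *ₛ h) n ≈ (f *ₛ h) n + (g *ₛ h) n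
  *ₛ-distribʳ f g h zero    = solve 3 (λ a b c → (a :+ b) :* c :+ con 0
    := a :* c :+ con 0 :+ (b :* c :+ con 0)) refl _ _ _
  *ₛ-distribʳ f g h (suc n) = trans (+-congˡ (*ₛ-distribʳ (tail f) (tail g) h n))
    (solve 5 (λ a b c x y → (a :+ b) :* c :+ (x :+ y) := a :* c :+ x :+ (b :* c :+ y))
      refl _ _ _ _ _)

  ·-*ₛ : ∀ x f h n → ((x · f) *ₛ h) n ≈ x * (f *ₛ h) n
  ·-*ₛ x f h zero    = solve 3 (λ x a b → x :* a :* b :+ con 0 := x :* (a :* b :+ con 0)) refl _ _ _
  ·-*ₛ x f h (suc n) = trans (+-congˡ (·-*ₛ x (tail f) h n))
    (solve 4 (λ x a b y → x :* a :* b :+ x :* y := x :* (a :* b :+ y)) refl _ _ _ _)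

  *ₛ-distribˡ : ∀ f g h n → (f *ₛ (g +ₛ h)) n ≈ (f *ₛ g) n + (f *ₛ h) n
  *ₛ-distribˡ f g h n = trans (*ₛ-comm f (g +ₛ h) n) (trans (*ₛ-distribʳ g h f n)
    (+-cong (*ₛ-comm g f n) (*ₛ-comm h f n)))

  *ₛ-· : ∀ x f h n → (f *ₛ (x · h)) n ≈ x * (f *ₛ h) n
  *ₛ-· x f h n = trans (*ₛ-comm f (x · h) n) (trans (·-*ₛ x h f n) (*-congˡ (*ₛ-comm h f n)))

  -- Induction works because the tail of `f *ₛ g` is `f 0 · tail g +ₛ tail f *ₛ g` by computation.
  *ₛ-assoc : ∀ f g h n → ((f *ₛ g) *ₛ h) n ≈ (f *ₛ (g *ₛ h)) n
  *ₛ-assoc f g h zero    = solve 3 (λ a b c →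
    (a :* b :+ con 0) :* c :+ con 0 := a :* (b :* c :+ con 0) :+ con 0) refl _ _ _
  *ₛ-assoc f g h (suc n) = begin
    (f 0 * g 0 + 0#) * h (suc n) + ((f 0 · tail g +ₛ tail f *ₛ g) *ₛ h) n
      ≈⟨ +-congˡ (*ₛ-distribʳ (f 0 · tail g) (tail f *ₛ g) h n) ⟩
    (f 0 * g 0 + 0#) * h (suc n) + (((f 0 · tail g) *ₛ h) n + (tail f *ₛ g *ₛ h) n)
      ≈⟨ +-congˡ (+-cong (·-*ₛ (f 0) (tail g) h n) (*ₛ-assoc (tail f) g h n)) ⟩
    (f 0 * g 0 + 0#) * h (suc n) + (f 0 * (tail g *ₛ h) n + (tail f *ₛ (g *ₛ h)) n)
      ≈⟨ solve 5 (λ a b c x y → (a :* b :+ con 0) :* c :+ (a :* x :+ y)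
           := a :* (b :* c :+ x) :+ y) refl _ _ _ _ _ ⟩
    f 0 * (g *ₛ h) (suc n) + (tail f *ₛ (g *ₛ h)) n ∎

  *ₛ-zeroʳ : ∀ f {h} n → (∀ k → h k ≈ 0#) → (f *ₛ h) n ≈ 0#
  *ₛ-zeroʳ f {h} n h≈0 = trans (*ₛ-∑ f h n)
    (∑-zero (suc n) λ k _ → trans (*-congˡ (h≈0 (n ∸ k))) (zeroʳ _))

  -- The operator x d/dx.
  θ : Series → Series
  θ f n = fromℕ n * f n

  θ-0 : ∀ f → θ f 0 ≈ 0#
  θ-0 f = trans (*-congʳ fromℤ-0) (zeroˡ _)

  θ-1ₛ : ∀ n → θ 1ₛ n ≈ 0#
  θ-1ₛ zero    = θ-0 1ₛ
  θ-1ₛ (suc n) = zeroʳ _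

  θ-*ₛ : ∀ f h n → θ (f *ₛ h) n ≈ (θ f *ₛ h) n + (f *ₛ θ h) n
  θ-*ₛ f h n = begin
    fromℕ n * (f *ₛ h) n
      ≈⟨ *-congˡ (*ₛ-∑ f h n) ⟩
    fromℕ n * (∑ (suc n) λ k → f k * h (n ∸ k))
      ≈⟨ ∑-*ˡ (suc n) ⟩
    (∑ (suc n) λ k → fromℕ n * (f k * h (n ∸ k)))
      ≈⟨ ∑-cong< (suc n) (λ k k≤n → trans (*-congʳ (split k (ℕ.s≤s⁻¹ k≤n)))
           (solve 4 (λ a b x y → (a :+ b) :* (x :* y) := a :* x :* y :+ x :* (b :* y)) refl _ _ _ _)) ⟩
    (∑ (suc n) λ k → θ f k * h (n ∸ k) + f k * θ h (n ∸ k))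
      ≈⟨ ∑-+ (suc n) ⟩
    (∑ (suc n) λ k → θ f k * h (n ∸ k)) + (∑ (suc n) λ k → f k * θ h (n ∸ k))
      ≈⟨ +-cong (*ₛ-∑ (θ f) h n) (*ₛ-∑ f (θ h) n) ⟨
    (θ f *ₛ h) n + (f *ₛ θ h) n ∎
    where
    split : ∀ k → k ≤ n → fromℕ n ≈ fromℕ k + fromℕ (n ∸ k)
    split k k≤n = trans (reflexive (cong fromℕ (≡.sym (ℕ.m+[n∸m]≡n k≤n)))) (fromℕ-+ k (n ∸ k))

  θ-^ₛ : ∀ f k n → θ (f ^ₛ suc k) n ≈ fromℕ (suc k) * (f ^ₛ k *ₛ θ f) n
  θ-^ₛ f zero n = begin
    θ (f *ₛ 1ₛ) n                   ≈⟨ θ-*ₛ f 1ₛ n ⟩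
    (θ f *ₛ 1ₛ) n + (f *ₛ θ 1ₛ) n   ≈⟨ +-cong (*ₛ-comm (θ f) 1ₛ n) (*ₛ-zeroʳ f n θ-1ₛ) ⟩
    (1ₛ *ₛ θ f) n + 0#              ≈⟨ +-identityʳ _ ⟩
    (1ₛ *ₛ θ f) n                   ≈⟨ *-identityˡ _ ⟨
    1# * (1ₛ *ₛ θ f) n              ≈⟨ *-congʳ fromℤ-1 ⟨
    fromℕ 1 * (1ₛ *ₛ θ f) n         ∎
  θ-^ₛ f (suc k) n = begin
    θ (f *ₛ f ^ₛ suc k) n
      ≈⟨ θ-*ₛ f (f ^ₛ suc k) n ⟩
    (θ f *ₛ f ^ₛ suc k) n + (f *ₛ θ (f ^ₛ suc k)) n
      ≈⟨ +-cong (*ₛ-comm (θ f) (f ^ₛ suc k) n) (*ₛ-congˡ f n (θ-^ₛ f k)) ⟩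
    (f ^ₛ suc k *ₛ θ f) n + (f *ₛ (fromℕ (suc k) · (f ^ₛ k *ₛ θ f))) n
      ≈⟨ +-congˡ (*ₛ-· (fromℕ (suc k)) f (f ^ₛ k *ₛ θ f) n) ⟩
    (f ^ₛ suc k *ₛ θ f) n + fromℕ (suc k) * (f *ₛ (f ^ₛ k *ₛ θ f)) n
      ≈⟨ +-cong (*-identityˡ _) (*-congˡ (*ₛ-assoc f (f ^ₛ k) (θ f) n)) ⟨
    1# * (f ^ₛ suc k *ₛ θ f) n + fromℕ (suc k) * (f ^ₛ suc k *ₛ θ f) n
      ≈⟨ distribʳ _ _ _ ⟨
    (1# + fromℕ (suc k)) * (f ^ₛ suc k *ₛ θ f) n
      ≈⟨ *-congʳ (trans (fromℕ-+ 1 (suc k)) (+-congʳ fromℤ-1)) ⟨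
    fromℕ (suc (suc k)) * (f ^ₛ suc k *ₛ θ f) n ∎

  -- The exponential series

  ^ₛ-low : ∀ f → f 0 ≈ 0# → ∀ k n → n < k → (f ^ₛ k) n ≈ 0#
  ^ₛ-low f f₀≈0 (suc k) zero    _         = trans (+-identityʳ _) (trans (*-congʳ f₀≈0) (zeroˡ _))
  ^ₛ-low f f₀≈0 (suc k) (suc n) (ℕ.s<s n<k) = begin
    f 0 * (f ^ₛ k) (suc n) + (tail f *ₛ f ^ₛ k) n
      ≈⟨ +-cong (trans (*-congʳ f₀≈0) (zeroˡ _)) (*ₛ-∑ (tail f) (f ^ₛ k) n) ⟩
    0# + (∑ (suc n) λ i → tail f i * (f ^ₛ k) (n ∸ i))
      ≈⟨ +-identityˡ _ ⟩
    (∑ (suc n) λ i → tail f i * (f ^ₛ k) (n ∸ i))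
      ≈⟨ ∑-zero (suc n) (λ i _ → trans
           (*-congˡ (^ₛ-low f f₀≈0 k (n ∸ i) (ℕ.≤-<-trans (ℕ.m∸n≤m n i) n<k))) (zeroʳ _)) ⟩
    0# ∎

  1/!_ : ℕ → Carrier
  1/! k = (1/ (k !)) {{k ℕ.!≢0}}

  1/!-suc : ∀ k → fromℕ (suc k) * 1/! (suc k) ≈ 1/! k
  1/!-suc k = begin
    fromℕ (suc k) * 1/! (suc k)
      ≈⟨ *-identityʳ _ ⟨
    fromℕ (suc k) * 1/! (suc k) * 1#
      ≈⟨ *-congˡ (fromℕ-inverse (k !) {{k ℕ.!≢0}}) ⟨
    fromℕ (suc k) * 1/! (suc k) * (fromℕ (k !) * 1/! k)
      ≈⟨ solve 4 (λ a b c d → a :* b :* (c :* d) := a :* c :* b :* d) refl _ _ _ _ ⟩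
    fromℕ (suc k) * fromℕ (k !) * 1/! (suc k) * 1/! k
      ≈⟨ *-congʳ (trans (*-congʳ (sym (fromℕ-* (suc k) (k !)))) (fromℕ-inverse (suc k !) {{suc k ℕ.!≢0}})) ⟩
    1# * 1/! k
      ≈⟨ *-identityˡ _ ⟩
    1/! k ∎

  -- The cut-off in `exp` varies with the coefficient; a common one for all coefficients is what
  -- lets the double sum in `θ-exp` be interchanged.
  exp-∑ : ∀ f → f 0 ≈ 0# → ∀ {n N} → n < N → exp f n ≈ ∑ N λ k → 1/! k * (f ^ₛ k) n
  exp-∑ f f₀≈0 {n} n<N = trans (sum≈∑ (suc n) λ k → 1/! k * (f ^ₛ k) n)
    (sym (∑-extend n<N λ k n<k → trans (*-congˡ (^ₛ-low f f₀≈0 k n n<k)) (zeroʳ _)))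

  exp-0 : ∀ f → exp f 0 ≈ 1#
  exp-0 f = trans (+-identityʳ _) (trans (*-identityʳ _) fromℤ-1)

  θ-exp : ∀ f → f 0 ≈ 0# → ∀ n → θ (exp f) n ≈ (exp f *ₛ θ f) n
  θ-exp f f₀≈0 n = begin
    fromℕ n * exp f n
      ≈⟨ *-congˡ (exp-∑ f f₀≈0 (ℕ.n<1+n n)) ⟩
    fromℕ n * (∑ (suc n) λ k → 1/! k * (f ^ₛ k) n)
      ≈⟨ ∑-*ˡ (suc n) ⟩
    (∑ (suc n) λ k → fromℕ n * (1/! k * (f ^ₛ k) n))
      ≈⟨ ∑-cong (suc n) (λ k → solve 3 (λ a b c → a :* (b :* c) := b :* (a :* c)) refl _ _ _) ⟩
    (∑ (suc n) λ k → 1/! k * θ (f ^ₛ k) n)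
      ≈⟨ ∑-suc n ⟩
    1/! 0 * θ 1ₛ n + (∑ n λ k → 1/! suc k * θ (f ^ₛ suc k) n)
      ≈⟨ +-cong (trans (*-congˡ (θ-1ₛ n)) (zeroʳ _)) (∑-cong n λ k → trans
           (*-congˡ (θ-^ₛ f k n))
           (trans (solve 3 (λ a b c → a :* (b :* c) := b :* a :* c) refl _ _ _)
                  (*-congʳ (1/!-suc k)))) ⟩
    0# + (∑ n λ k → 1/! k * (f ^ₛ k *ₛ θ f) n)
      ≈⟨ +-comm _ _ ⟩
    (∑ n λ k → 1/! k * (f ^ₛ k *ₛ θ f) n) + 0#
      -- Shifting k + 1 to k leaves the terms k < n. The term k = n is restored for free: f^n has
      -- order at least n and `θ f` at least 1.
      ≈⟨ +-congˡ (trans (*-congˡ top) (zeroʳ _)) ⟨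
    (∑ n λ k → 1/! k * (f ^ₛ k *ₛ θ f) n) + 1/! n * (f ^ₛ n *ₛ θ f) n
      ≈⟨ ∑-last n ⟨
    (∑ (suc n) λ k → 1/! k * (f ^ₛ k *ₛ θ f) n)
      ≈⟨ ∑-cong (suc n) (λ k → trans (*-congˡ (*ₛ-∑ (f ^ₛ k) (θ f) n))
           (trans (∑-*ˡ (suc n)) (∑-cong (suc n) λ i → sym (*-assoc _ _ _)))) ⟩
    (∑ (suc n) λ k → ∑ (suc n) λ i → 1/! k * (f ^ₛ k) i * θ f (n ∸ i))
      ≈⟨ ∑-swap (suc n) (suc n) ⟩
    (∑ (suc n) λ i → ∑ (suc n) λ k → 1/! k * (f ^ₛ k) i * θ f (n ∸ i))
      ≈⟨ ∑-cong (suc n) (λ i → ∑-*ʳ (suc n)) ⟨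
    (∑ (suc n) λ i → (∑ (suc n) λ k → 1/! k * (f ^ₛ k) i) * θ f (n ∸ i))
      ≈⟨ ∑-cong< (suc n) (λ i i<1+n → *-congʳ (exp-∑ f f₀≈0 i<1+n)) ⟨
    (∑ (suc n) λ i → exp f i * θ f (n ∸ i))
      ≈⟨ *ₛ-∑ (exp f) (θ f) n ⟨
    (exp f *ₛ θ f) n ∎
    where
    top : (f ^ₛ n *ₛ θ f) n ≈ 0#
    top = begin
      (f ^ₛ n *ₛ θ f) n
        ≈⟨ *ₛ-∑ (f ^ₛ n) (θ f) n ⟩
      (∑ (suc n) λ i → (f ^ₛ n) i * θ f (n ∸ i))
        ≈⟨ ∑-last n ⟩
      (∑ n λ i → (f ^ₛ n) i * θ f (n ∸ i)) + (f ^ₛ n) n * θ f (n ∸ n)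
        ≈⟨ +-cong (∑-zero n λ i i<n → trans (*-congʳ (^ₛ-low f f₀≈0 n i i<n)) (zeroˡ _))
             (trans (*-congˡ (trans (reflexive (cong (θ f) (ℕ.n∸n≡0 n))) (θ-0 f))) (zeroʳ _)) ⟩
      0# + 0#
        ≈⟨ +-identityˡ 0# ⟩
      0# ∎

  -- Logarithmic derivatives, as equations free of division

  LogDerivative : Series → Series → Set ℓ
  LogDerivative f a = ∀ n → θ f n ≈ (f *ₛ a) n

  logDerivative-*ₛ : ∀ f h a b → LogDerivative f a → LogDerivative h b →
                     LogDerivative (f *ₛ h) (a +ₛ b)
  logDerivative-*ₛ f h a b θf θh n = begin
    θ (f *ₛ h) n                             ≈⟨ θ-*ₛ f h n ⟩
    (θ f *ₛ h) n + (f *ₛ θ h) n              ≈⟨ +-cong (*ₛ-congʳ h n θf) (*ₛ-congˡ f n θh) ⟩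
    (f *ₛ a *ₛ h) n + (f *ₛ (h *ₛ b)) n      ≈⟨ +-cong (*ₛ-assoc f a h n) (sym (*ₛ-assoc f h b n)) ⟩
    (f *ₛ (a *ₛ h)) n + (f *ₛ h *ₛ b) n      ≈⟨ +-congʳ (*ₛ-congˡ f n (*ₛ-comm a h)) ⟩
    (f *ₛ (h *ₛ a)) n + (f *ₛ h *ₛ b) n      ≈⟨ +-congʳ (*ₛ-assoc f h a n) ⟨
    (f *ₛ h *ₛ a) n + (f *ₛ h *ₛ b) n        ≈⟨ *ₛ-distribˡ (f *ₛ h) a b n ⟨
    (f *ₛ h *ₛ (a +ₛ b)) n                   ∎

  fromℕ-cancelˡ : ∀ n .{{_ : NonZero n}} {x y} → fromℕ n * x ≈ fromℕ n * y → x ≈ y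
  fromℕ-cancelˡ n {x} {y} nx≈ny = trans (sym (undo x)) (trans (*-congˡ nx≈ny) (undo y))
    where
    undo : ∀ z → 1/ n * (fromℕ n * z) ≈ z
    undo z = trans (solve 3 (λ a b c → a :* (b :* c) := b :* a :* c) refl _ _ _)
      (trans (*-congʳ (fromℕ-inverse n)) (*-identityˡ z))

  -- f is determined by f 0 and its logarithmic derivative a through the
  -- recurrence n fₙ = Σ fₙ₋ₖ aₖ, in which only k ≥ 1 contributes.
  logDerivative-unique : ∀ f h a b M → a 0 ≈ 0# → b 0 ≈ 0# → (∀ n → n < M → a (suc n) ≈ b (suc n)) →
    LogDerivative f a → LogDerivative h b → f 0 ≈ h 0 → ∀ n → n ≤ M → f n ≈ h n
  logDerivative-unique f h a b M a₀≈0 b₀≈0 a≈b θf θh f₀≈h₀ n = below (suc n) n (ℕ.n<1+n n)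
    where
    recurrence : ∀ f a → a 0 ≈ 0# → LogDerivative f a →
                 ∀ n → fromℕ (suc n) * f (suc n) ≈ (f *ₛ tail a) n
    recurrence f a a₀≈0 θf n = trans (θf (suc n)) (trans (*ₛ-sucʳ f a n)
      (trans (+-congˡ (trans (*-congˡ a₀≈0) (zeroʳ _))) (+-identityʳ _)))

    -- N is fuel for strong induction: the recurrence at n + 1 calls on every coefficient up to n.
    below : ∀ N n → n < N → n ≤ M → f n ≈ h n
    below (suc N) zero    _           _   = f₀≈h₀
    below (suc N) (suc n) (ℕ.s<s n<N) n<M = fromℕ-cancelˡ (suc n) (begin
      fromℕ (suc n) * f (suc n)  ≈⟨ recurrence f a a₀≈0 θf n ⟩
      (f *ₛ tail a) n            ≈⟨ *ₛ-cong f h (tail a) (tail b) n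
                                      (λ k k≤n → below N k (ℕ.≤-<-trans k≤n n<N) (ℕ.≤-trans k≤n (ℕ.<⇒≤ n<M)))
                                      (λ k k≤n → a≈b k (ℕ.≤-<-trans k≤n n<M)) ⟩
      (h *ₛ tail b) n            ≈⟨ recurrence h b b₀≈0 θh n ⟨
      fromℕ (suc n) * h (suc n)  ∎)

  -- Partial products and the Euler product

  module _ (h : (m : ℕ) → .{{NonZero m}} → Series) where

    partialLog : ℕ → Series
    partialLog M n = ∑ M λ m → h (suc m) n

    ∏≤-exp-0 : ∀ M → ∏≤ (λ m → exp (h m)) M 0 ≈ 1#
    ∏≤-exp-0 zero    = refl
    ∏≤-exp-0 (suc M) = trans (+-identityʳ _) (trans
      (*-cong (∏≤-exp-0 M) (exp-0 (h (suc M)))) (*-identityˡ 1#))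

    ∏≤-exp : (∀ m → h (suc m) 0 ≈ 0#) → ∀ M →
             LogDerivative (∏≤ (λ m → exp (h m)) M) (θ (partialLog M))
    ∏≤-exp h₀≈0 zero    n = trans (θ-1ₛ n) (sym
      (*ₛ-zeroʳ 1ₛ {θ (partialLog 0)} n λ _ → trans (*-congˡ ∑-0) (zeroʳ _)))
    ∏≤-exp h₀≈0 (suc M) n = trans
      (logDerivative-*ₛ P (exp (h (suc M))) (θ (partialLog M)) (θ (h (suc M)))
        (∏≤-exp h₀≈0 M) (θ-exp (h (suc M)) (h₀≈0 M)) n)
      (*ₛ-congˡ (P *ₛ exp (h (suc M))) {θ (partialLog M) +ₛ θ (h (suc M))} {θ (partialLog (suc M))} n
        λ k → trans (sym (distribˡ _ _ _)) (*-congˡ (sym (∑-last M))))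
      where P = ∏≤ (λ m → exp (h m)) M

  -- At exponent n = m r, the factor n from `θ` meets the coefficient 1/r and leaves m.
  θ-log : ∀ m β n → θ (β · log[1-x^ suc m ]) n
                    ≈ - (∑ n λ r → δ (suc m ℕ.* suc r) n * (fromℕ (suc m) * β))
  θ-log m β n = begin
    -- The `0#` is the term r = 0 of the logarithm.
    fromℕ n * (β * - (0# + _))
      ≈⟨ *-congˡ (*-congˡ (-‿cong (trans (+-identityˡ _) (sum≈∑ n λ r → (1/ suc r) * (X^ (suc m ℕ.* suc r)) n)))) ⟩
    fromℕ n * (β * - (∑ n λ r → (1/ suc r) * (X^ (suc m ℕ.* suc r)) n))
      ≈⟨ trans (*-congˡ (sym (-‿distribʳ-* _ _))) (sym (-‿distribʳ-* _ _)) ⟩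
    - (fromℕ n * (β * (∑ n λ r → (1/ suc r) * (X^ (suc m ℕ.* suc r)) n)))
      ≈⟨ -‿cong (trans (*-congˡ (∑-*ˡ n)) (∑-*ˡ n)) ⟩
    - (∑ n λ r → fromℕ n * (β * ((1/ suc r) * (X^ (suc m ℕ.* suc r)) n)))
      ≈⟨ -‿cong (∑-cong n term) ⟩
    - (∑ n λ r → δ (suc m ℕ.* suc r) n * (fromℕ (suc m) * β)) ∎
    where
    term : ∀ r → fromℕ n * (β * ((1/ suc r) * (X^ (suc m ℕ.* suc r)) n))
                 ≈ δ (suc m ℕ.* suc r) n * (fromℕ (suc m) * β)
    term r with suc m ℕ.* suc r ℕ.≟ n
    ... | yes ≡.refl = begin
      fromℕ (suc m ℕ.* suc r) * (β * ((1/ suc r) * (X^ (suc m ℕ.* suc r)) (suc m ℕ.* suc r)))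
        ≈⟨ *-cong (fromℕ-* (suc m) (suc r)) (*-congˡ (*-congˡ (reflexive (X^-δ (suc m ℕ.* suc r) (suc m ℕ.* suc r))))) ⟩
      fromℕ (suc m) * fromℕ (suc r) * (β * ((1/ suc r) * δ (suc m ℕ.* suc r) (suc m ℕ.* suc r)))
        ≈⟨ solve 5 (λ a b c d e → a :* b :* (c :* (d :* e)) := b :* d :* (e :* (a :* c))) refl _ _ _ _ _ ⟩
      fromℕ (suc r) * 1/ suc r * (δ (suc m ℕ.* suc r) (suc m ℕ.* suc r) * (fromℕ (suc m) * β))
        ≈⟨ trans (*-congʳ (fromℕ-inverse (suc r))) (*-identityˡ _) ⟩
      δ (suc m ℕ.* suc r) (suc m ℕ.* suc r) * (fromℕ (suc m) * β) ∎
    ... | no mr≢n = begin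
      fromℕ n * (β * ((1/ suc r) * (X^ (suc m ℕ.* suc r)) n))
        ≈⟨ *-congˡ (*-congˡ (*-congˡ (trans (reflexive (X^-δ (suc m ℕ.* suc r) n)) (δ-≢ mr≢n)))) ⟩
      fromℕ n * (β * ((1/ suc r) * 0#))
        ≈⟨ solve 3 (λ a b c → a :* (b :* (c :* con 0)) := con 0) refl _ _ _ ⟩
      0#
        ≈⟨ δ*-≢ _ mr≢n ⟨
      δ (suc m ℕ.* suc r) n * (fromℕ (suc m) * β) ∎

  bellExponent-⋆ : ∀ g m .{{_ : NonZero m}} → fromℕ m * bellExponent g m ≈ (μᴬ ⋆ g) m
  bellExponent-⋆ g m = trans (sym (*-assoc _ _ _)) (trans (*-congʳ (fromℕ-inverse m)) (*-identityˡ _))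

  bellLog : Arith → (m : ℕ) → .{{NonZero m}} → Series
  bellLog g m = bellExponent g m · log[1-x^ m ]

  bellLog-0 : ∀ g m → bellLog g (suc m) 0 ≈ 0#
  bellLog-0 g m = trans (*-congˡ (trans (-‿cong (+-identityˡ 0#)) -0#≈0#)) (zeroʳ _)

  θ-partialLog : ∀ g M n → n < M → θ (partialLog (bellLog g) M) (suc n) ≈ - g (suc n)
  θ-partialLog g M n n<M = begin
    fromℕ (suc n) * (∑ M λ m → bellLog g (suc m) (suc n))
      ≈⟨ ∑-*ˡ M ⟩
    (∑ M λ m → θ (bellLog g (suc m)) (suc n))
      ≈⟨ ∑-cong M (λ m → θ-log m (bellExponent g (suc m)) (suc n)) ⟩
    (∑ M λ m → - (∑ (suc n) λ r → δ (suc m ℕ.* suc r) (suc n) * (fromℕ (suc m) * bellExponent g (suc m))))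
      ≈⟨ ∑-neg M ⟩
    - (∑ M λ m → ∑ (suc n) λ r → δ (suc m ℕ.* suc r) (suc n) * (fromℕ (suc m) * bellExponent g (suc m)))
      -- The inner range is stretched to M and a factor 1 inserted, so that the double sum becomes
      -- (μ * g) * 1 over the box of side M.
      ≈⟨ -‿cong (∑-cong< M λ m m<M → trans
           (sym (∑-extend n<M λ r n<r → δ*-≢ _ λ eq → *≢-≥ {r} {m} ℕ.≤-refl n<r
             (≡.trans (ℕ.*-comm (suc r) (suc m)) eq)))
           (∑-cong M λ r → *-congˡ (trans (bellExponent-⋆ g (suc m))
             (trans (⋆-conv μᴬ g m<M) (sym (*-identityʳ _)))))) ⟩
    - conv M (λ m → conv M (λ i → μᴬ (suc i)) (λ j → g (suc j)) (suc m)) one (suc n)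
      ≈⟨ -‿cong (möbius-inversion n<M λ j → g (suc j)) ⟩
    - g (suc n) ∎

  -- The exponent inside `bellTransform` is an anonymous pattern-matching function. Passing it
  -- through `F ≡ exp f` lets unification supply it.
  exp-eulerProduct : ∀ g {F} f → F ≡ exp f → f 0 ≈ 0# → (∀ n → θ f (suc n) ≈ - g (suc n)) →
                     F ≐∏ λ m → [1-x^ m ]^ bellExponent g m
  -- The partial product up to M is correct through x^M, so M ≥ k settles all coefficients below k.
  exp-eulerProduct g f ≡.refl f₀≈0 θf k = k , λ M k≤M n n<k →
    logDerivative-unique (∏≤ (λ m → exp (bellLog g m)) M) (exp f) (θ (partialLog (bellLog g) M)) (θ f) M
      (θ-0 (partialLog (bellLog g) M)) (θ-0 f)
      (λ n n<M → trans (θ-partialLog g M n n<M) (sym (θf n)))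
      (∏≤-exp (bellLog g) (bellLog-0 g) M) (θ-exp f f₀≈0)
      (trans (∏≤-exp-0 (bellLog g) M) (sym (exp-0 f)))
      n (ℕ.≤-trans (ℕ.<⇒≤ n<k) k≤M)

  bellTransform-eulerProduct : ∀ g → bellTransform g ≐∏ λ m → [1-x^ m ]^ bellExponent g m
  bellTransform-eulerProduct g = exp-eulerProduct g _ ≡.refl -0#≈0# λ n → begin
    fromℕ (suc n) * - (g (suc n) * 1/ suc n)
      ≈⟨ -‿distribʳ-* _ _ ⟨
    - (fromℕ (suc n) * (g (suc n) * 1/ suc n))
      ≈⟨ -‿cong (solve 3 (λ a b c → a :* (b :* c) := b :* (a :* c)) refl _ _ _) ⟩
    - (g (suc n) * (fromℕ (suc n) * 1/ suc n))
      ≈⟨ -‿cong (trans (*-congˡ (fromℕ-inverse (suc n))) (*-identityʳ _)) ⟩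
    - g (suc n) ∎

  bellExponent-⇔ : ∀ g m .{{_ : NonZero m}} b → (b ≈ bellExponent g m) ⇔ (fromℕ m * b ≈ (μᴬ ⋆ g) m)
  bellExponent-⇔ g m b = mk⇔
    (λ b≈ → trans (*-congˡ b≈) (bellExponent-⋆ g m))
    (λ mb≈ → fromℕ-cancelˡ m (trans mb≈ (sym (bellExponent-⋆ g m))))

-- Specialisation to ℂ

open import Defs
open CommutativeRing ℂ-commutativeRing using (_≈_; _*_; rawRing)

ℚ⇒ℂ-isRingHomomorphism : RingMorphisms.IsRingHomomorphism ℚ.+-*-rawRing rawRing ℚ⇒ℂ
ℚ⇒ℂ-isRingHomomorphism = record
  { isSemiringHomomorphism = record
    { isNearSemiringHomomorphism = record
      { +-isMonoidHomomorphism = record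
        { isMagmaHomomorphism = record
          { isRelHomomorphism = record { cong = λ { ≡.refl → ℂ-ring.refl } }
          ; homo = λ _ _ → pointwise (λ _ → ≡.refl) +i pointwise (λ _ → ≡.refl)
          }
        ; ε-homo = ℂ-ring.refl
        }
      -- Complex multiplication leaves products with the zero imaginary parts, to be cleared over ℚ.
      ; *-homo = λ p q →
          pointwise (λ _ → solve 2 (λ p q → p :* q := p :* q :+ :- (con 0ℚ :* con 0ℚ)) ≡.refl p q)
          +i pointwise (λ _ → solve 2 (λ p q → con 0ℚ := p :* con 0ℚ :+ con 0ℚ :* q) ≡.refl p q)
      }
    ; 1#-homo = ℂ-ring.refl
    }
  ; -‿homo = λ _ → pointwise (λ _ → ≡.refl) +i pointwise (λ _ → ≡.refl)
  }
  where
  module ℂ-ring = CommutativeRing ℂ-commutativeRing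
  open ℚ-Solver.+-*-Solver

open EulerProduct ℂ-commutativeRing ℚ⇒ℂ ℚ⇒ℂ-isRingHomomorphism
  using (bellTransform-eulerProduct; bellExponent-⇔)

theorem2p1 : (g : Arith) →
    (bellTransform g ≐∏ λ m → [1-x^ m ]^ bellExponent g m)
    × ((m : ℕ) .{{_ : NonZero m}} (b : ℂ) →
    (b ≈ bellExponent g m) ⇔ (fromℕ m * b ≈ (μᴬ ⋆ g) m))
theorem2p1 g = bellTransform-eulerProduct g , λ m b → bellExponent-⇔ g m b
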